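{- Let $\mathbb K$ be a field of characteristic zero, $m,n$ positive integers and $r$ an integer with $2<r<n$. Let $E$ be the edge set of the complete bipartite graph $K_{m,n}$, $N=\#E$, and identify $E$ with $\{1,\ldots,N\}$. Let $M^r_{K_{m,n}}$ be the matroid on $E$ whose bases are the edge sets of the forests in $K_{m,n}$ with exactly $r$ edges, $\Phi=\sum_B\prod_{b\in B}x_b$ (sum over bases), and $A=\mathbb K[x_1,\ldots,x_N]/\mathrm{Ann}(\Phi)=\bigoplus_{j=0}^rA_j$. Let $L=x_1+\cdots+x_N$. Then the multiplication map $\times L^{r-2}\colon A_1\to A_{r-1}$ is bijective.
   Context: $\mathrm{Ann}(\Phi)=\{P\in\mathbb K[x_1,\ldots,x_N]: P(\partial/\partial x_1,\ldots,\partial/\partial x_N)\Phi=0\}$, a homogeneous ideal; $A_j$ is the degree-$j$ homogeneous component of the graded quotient algebra $A$. The matroid $M^r_{K_{m,n}}$ is the truncation to rank $r$ of the graphic matroid of $K_{m,n}$. -}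

module Defs where

open import Level using (Level; _⊔_) renaming (suc to lsuc)
open import Algebra.Bundles using (CommutativeRing)
open import Data.Nat using (ℕ; zero; suc; _≤_; _∸_; _<_)
open import Data.Empty using (⊥)
open import Data.Fin using (Fin; combine; inject₁; fromℕ) renaming (suc to fsuc; zero to fzero)
open import Data.Vec using (Vec; []; _∷_; lookup; zipWith; foldr; replicate; tabulate)
open import Data.List as List using (List; concatMap; upTo)
open import Data.Product using (Σ; ∃; _×_; _,_)
open import Data.Sum using (_⊎_; inj₁; inj₂)
open import Relation.Nullary using (¬_)
open import Relation.Binary.PropositionalEquality using (_≡_)
open import Function.Definitions using (Injective)

record Field (c ℓ : Level) : Set (lsuc (c ⊔ ℓ)) where
  field
    commutativeRing : CommutativeRing c ℓ
  open CommutativeRing commutativeRing public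
  field
    1≉0     : ¬ (1# ≈ 0#)
    inverse : ∀ x → ¬ (x ≈ 0#) → ∃ λ y → (x * y) ≈ 1#

  fromℕ' : ℕ → Carrier
  fromℕ' zero    = 0#
  fromℕ' (suc k) = 1# + fromℕ' k

  CharZero : Set ℓ
  CharZero = ∀ k → ¬ (fromℕ' (suc k) ≈ 0#)

Mon : ℕ → Set
Mon N = Vec ℕ N

deg : ∀ {N} → Mon N → ℕ
deg = foldr _ Data.Nat._+_ 0

monos : (N j : ℕ) → List (Mon N)
monos zero    zero    = List.[ [] ]
monos zero    (suc j) = List.[]
monos (suc N) j = concatMap (λ k → List.map (k ∷_) (monos N (j ∸ k))) (upTo (suc j))

below : ∀ {N} → Mon N → List (Mon N)
below []      = List.[ [] ]
below (a ∷ α) = concatMap (λ k → List.map (k ∷_) (below α)) (upTo (suc a))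

rise : ℕ → ℕ → ℕ
rise g zero    = 1
rise g (suc a) = (g Data.Nat.+ suc a) Data.Nat.* rise g a

-- ∂^α x^(γ+α) = fall γ α · x^γ  with  fall γ α = Π_i (γ_i+α_i)!/γ_i!
fall : ∀ {N} → Mon N → Mon N → ℕ
fall []      []      = 1
fall (g ∷ γ) (a ∷ α) = rise g a Data.Nat.* fall γ α

-- Polynomials over a field, represented by their coefficient functions.
-- (A coefficient function Mon N → K need not have finite support in
-- general; we only ever use homogeneous ones, whose support is finite.)

module Poly {c ℓ} (K : Field c ℓ) (N : ℕ) where
  open Field K

  Pol : Set c
  Pol = Mon N → Carrier

  Σ[_]_ : ∀ {A : Set} → List A → (A → Carrier) → Carrier
  Σ[ xs ] f = List.foldr (λ x acc → f x + acc) 0# xs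

  _⊕_ : Pol → Pol → Pol
  (f ⊕ g) α = f α + g α

  ⊖_ : Pol → Pol
  (⊖ f) α = - f α

  _⊗_ : Pol → Pol → Pol
  (f ⊗ g) α = Σ[ below α ] (λ β → f β * g (zipWith _∸_ α β))

  one : Pol
  one α with deg α
  ... | zero  = 1#
  ... | suc _ = 0#

  _^^_ : Pol → ℕ → Pol
  f ^^ zero  = one
  f ^^ suc k = f ⊗ (f ^^ k)

  IsHomog : ℕ → Pol → Set ℓ
  IsHomog j f = ∀ α → ¬ (deg α ≡ j) → f α ≈ 0#

  Lsum : Pol
  Lsum α with deg α
  ... | suc zero = 1#
  ... | _        = 0#

  -- P(∂/∂x) f for P homogeneous of degree j:
  --   P(∂) f = Σ_{|α|=j} P_α ∂^α f,   (∂^α f)_γ = fall γ α · f_{γ+α}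
  applyDiff : ℕ → Pol → Pol → Pol
  applyDiff j P f γ =
    Σ[ monos N j ] (λ α → P α * (fromℕ' (fall γ α) * f (zipWith Data.Nat._+_ γ α)))

  InAnn : Pol → ℕ → Pol → Set ℓ
  InAnn Φ j P = ∀ γ → applyDiff j P Φ γ ≈ 0#

-- The complete bipartite graph K_{m,n} and the truncated matroid.
-- Vertices: Fin m ⊎ Fin n; edges: pairs (a , b), identified with
-- variables Fin (m * n) via  combine a b.

module Bip (m n : ℕ) where

  V : Set
  V = Fin m ⊎ Fin n

  -- edge set F ⊆ E given by a 0/1 exponent vector (its support)
  InSupp : Mon (m Data.Nat.* n) → Fin m → Fin n → Set
  InSupp α a b = lookup α (combine a b) ≡ 1

  Adj : Mon (m Data.Nat.* n) → V → V → Set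
  Adj α (inj₁ a) (inj₂ b) = InSupp α a b
  Adj α (inj₂ b) (inj₁ a) = InSupp α a b
  Adj α _        _        = ⊥

  HasCycle : Mon (m Data.Nat.* n) → Set
  HasCycle α = Σ ℕ λ k → Σ (Fin (suc (suc (suc k))) → V) λ v →
      Injective _≡_ _≡_ v
    × (∀ (i : Fin (suc (suc k))) → Adj α (v (inject₁ i)) (v (fsuc i)))
    × Adj α (v (fromℕ (suc (suc k)))) (v fzero)

  IsForest : Mon (m Data.Nat.* n) → Set
  IsForest α = ¬ HasCycle α

  IsBasisMon : ℕ → Mon (m Data.Nat.* n) → Set
  IsBasisMon r α = (∀ i → lookup α i ≤ 1) × (deg α ≡ r) × IsForest α

  IsBasisGenPoly : ∀ {c ℓ} (K : Field c ℓ) → ℕ → Poly.Pol K (m Data.Nat.* n) → Set ℓ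
  IsBasisGenPoly K r Φ =
    ∀ α → (IsBasisMon r α → Φ α ≈ 1#) × (¬ IsBasisMon r α → Φ α ≈ 0#)
    where open Field K

{-# OPTIONS --safe #-}

-- Since Φ is squarefree, ℓ · L^(r-2) acts on Φ by (r-2)! times the matrix whose entry at edges e, f is
-- the number of (r-1)-edge forests D containing e and not joining the ends of f. By S_m × S_n-symmetry
-- the entry is 0, p, q or s as e and f are equal, share a left vertex, share a right vertex or are
-- disjoint. Such a matrix is inverted explicitly through row, column and total sums as soon as p ≤ s,
-- q ≤ s and s < p + q.
--   s < p + q: if ab ∈ D, then a′ ≁ b′ implies a ≁ b′ or a′ ≁ b; a star at a satisfies all three.
--   p ≤ s: D with a ≁ b′ and a′ ~ b′ is sent to a forest with a ~ b′ and a′ ≁ b′ by moving the branch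
--   towards b′ from a′ to a; q ≤ s is the same with the two sides exchanged.

module Submission where

open import Defs

-- Adding f to D must give a squarefree monomial and create no cycle; both demands together say
-- exactly that D does not join the ends of f. Connectivity is therefore the basic notion, and
-- forests are handled as edge sets all of whose members are bridges. The three inequalities matter
-- through v = s - p, w = s - q and u = p + q - s: these are natural numbers and u is positive, so
-- off the all-ones vector every eigenvalue is, up to sign, a sum of natural numbers containing u,
-- while on the all-ones vector it is a row sum, which is positive. In characteristic zero no
-- divisor can vanish, whatever the counts are, and no forest has to be enumerated explicitly. A
-- form of degree r - 1 sends Φ to a linear form, so its class modulo the annihilator is known from
-- N coefficients, and surjectivity is again the solvability of this one linear system.

module Combinatorics where

  open import Data.Nat as ℕ using (ℕ; zero; suc; _+_; _*_; _∸_; _≤_; _<_; z≤n; s≤s)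
  open import Data.Nat.Properties as ℕₚ using (≤-trans; ≤-refl; ≤-reflexive)
  open import Data.Empty using (⊥; ⊥-elim)
  open import Data.Bool using (if_then_else_)
  open import Data.Fin as Fin using (Fin; toℕ; combine; quotient; remainder; inject₁; fromℕ) renaming (zero to fzero; suc to fsuc)
  open import Data.Product using (Σ; ∃; _×_; _,_; proj₁; proj₂)
  open import Data.Sum using (_⊎_; inj₁; inj₂; [_,_]′)
  open import Data.List as List using (List; []; _∷_; _++_; length; filter; upTo)
  open import Data.List.Properties using (length-++; filter-none)
  open import Data.List.Membership.Propositional using (_∈_; find)
  open import Data.List.Membership.Propositional.Properties using (∈-∃++; ∈-++⁺ˡ; ∈-++⁺ʳ; ∈-++⁻; ∈-filter⁺; ∈-filter⁻; ∈-concatMap⁺; ∈-concatMap⁻; ∈-map⁺; ∈-map⁻; ∈-upTo⁺; ∈-upTo⁻; ∈-length)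
  open import Data.List.Relation.Unary.Any as Any using (here; there)
  open import Data.List.Relation.Unary.All as All using ([]; _∷_)
  import Data.List.Relation.Unary.All.Properties as Allₚ
  open import Data.List.Relation.Unary.AllPairs using ([]; _∷_)
  import Data.List.Relation.Unary.AllPairs.Properties as AllPairsₚ
  open import Data.List.Relation.Unary.Unique.Propositional using (Unique)
  import Data.List.Relation.Unary.Unique.Propositional.Properties as Uniqueₚ
  open import Data.Vec using (Vec; []; _∷_; lookup; _[_]≔_; tabulate; zipWith; replicate)
  import Data.Vec.Properties as Vecₚ
  open import Relation.Unary using (Pred; Decidable)
  open import Relation.Nullary using (¬_; Dec; yes; no; does)
  open import Relation.Binary.PropositionalEquality using (_≡_; _≢_; refl; sym; trans; cong; cong₂; subst; subst₂; module ≡-Reasoning)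
  open import Algebra.Properties.CommutativeSemigroup ℕₚ.+-commutativeSemigroup using (interchange)
  open import Level using (0ℓ)
  import Data.Fin.Properties as Finₚ
  open import Data.Fin.Permutation using (permutation)
  open import Relation.Nullary.Decidable using (map′; _×-dec_; _⊎-dec_; ¬?; _→-dec_)
  open import Relation.Binary.Definitions using (DecidableEquality; Symmetric)
  open import Relation.Binary.Construct.Closure.ReflexiveTransitive as Star using (Star; ε; _◅_; _◅◅_)
  open import Algebra.Properties.CommutativeMonoid.Sum ℕₚ.+-0-commutativeMonoid using (sum; sum-permute)
  open import Data.Nat.Tactic.RingSolver using (solve-∀)
  import Data.Sum.Properties as Sumₚ
  open import Function.Definitions using (Injective)

  -- Comparing numbers of list elements.

  length-≤-via : ∀ {A B : Set} (R : A → B → Set) {xs ys} → Unique xs →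
    (∀ {x} → x ∈ xs → ∃ λ y → y ∈ ys × R x y) →
    (∀ {x x′ y} → R x y → R x′ y → x ≡ x′) → length xs ≤ length ys
  length-≤-via R {[]} _ _ _ = z≤n
  length-≤-via R {x ∷ xs} {ys} (x∉xs ∷ u) total inj
    with y , y∈ys , xRy ← total (here refl)
    with as , bs , refl ← ∈-∃++ y∈ys = begin
      suc (length xs)                ≤⟨ s≤s (length-≤-via R u total′ inj) ⟩
      suc (length (as ++ bs))        ≡⟨ cong suc (length-++ as) ⟩
      suc (length as + length bs)    ≡⟨ ℕₚ.+-suc (length as) (length bs) ⟨
      length as + length (y ∷ bs)    ≡⟨ length-++ as ⟨
      length (as ++ y ∷ bs)          ∎
    where
    open ℕₚ.≤-Reasoning
    -- Left-uniqueness keeps the partners of the tail away from the removed `y`.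
    total′ : ∀ {x′} → x′ ∈ xs → ∃ λ y′ → y′ ∈ as ++ bs × R x′ y′
    total′ x′∈xs with y′ , y′∈ys , x′Ry′ ← total (there x′∈xs) with ∈-++⁻ as y′∈ys
    ... | inj₁ y′∈as         = y′ , ∈-++⁺ˡ y′∈as , x′Ry′
    ... | inj₂ (there y′∈bs) = y′ , ∈-++⁺ʳ as y′∈bs , x′Ry′
    ... | inj₂ (here refl)   = ⊥-elim (All.lookup x∉xs x′∈xs (inj xRy x′Ry′))

  count : ∀ {A : Set} {P : Pred A 0ℓ} → Decidable P → List A → ℕ
  count P? xs = length (filter P? xs)

  count-pos : ∀ {A : Set} {P : Pred A 0ℓ} (P? : Decidable P) {x xs} → x ∈ xs → P x → 0 < count P? xs
  count-pos P? x∈ px = ∈-length (∈-filter⁺ P? x∈ px)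

  indicator : ∀ {P : Set} → Dec P → ℕ
  indicator P? = if does P? then 1 else 0

  count-∷ : ∀ {A : Set} {P : Pred A 0ℓ} (P? : Decidable P) x xs →
    count P? (x ∷ xs) ≡ indicator (P? x) + count P? xs
  count-∷ P? x xs with P? x
  ... | yes _ = refl
  ... | no _  = refl

  module _ {A : Set} {P Q : Pred A 0ℓ} (P? : Decidable P) (Q? : Decidable Q) where

    -- An injection is given as a relation that may be many-valued: in the exchange argument a
    -- partner is exhibited by a choice of edge, and only recovering the source from the partner has
    -- to be unambiguous.
    count-≤-via : (R : A → A → Set) {xs : List A} → Unique xs →
      (∀ {x} → P x → ∃ λ y → y ∈ xs × Q y × R x y) →
      (∀ {x x′ y} → R x y → R x′ y → x ≡ x′) → count P? xs ≤ count Q? xs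
    count-≤-via R {xs} u total inj = length-≤-via R (Uniqueₚ.filter⁺ P? u) total′ inj
      where
      total′ : ∀ {x} → x ∈ filter P? xs → ∃ λ y → y ∈ filter Q? xs × R x y
      total′ x∈ with y , y∈ , Qy , xRy ← total (proj₂ (∈-filter⁻ P? {xs = xs} x∈)) = y , ∈-filter⁺ Q? y∈ Qy , xRy

    module _ {T : Pred A 0ℓ} (T? : Decidable T) (split : ∀ {x} → T x → P x ⊎ Q x) where

      private
        indicator-≤ : ∀ x → indicator (T? x) ≤ indicator (P? x) + indicator (Q? x)
        indicator-≤ x with T? x | P? x | Q? x
        ... | no _  | _     | _     = z≤n
        ... | yes _ | yes _ | _     = s≤s z≤n
        ... | yes _ | no _  | yes _ = s≤s z≤n
        ... | yes t | no ¬p | no ¬q with split t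
        ...   | inj₁ p = ⊥-elim (¬p p)
        ...   | inj₂ q = ⊥-elim (¬q q)

        indicator-< : ∀ x → P x → Q x → indicator (T? x) < indicator (P? x) + indicator (Q? x)
        indicator-< x p q with T? x | P? x | Q? x
        ... | _     | no ¬p | _     = ⊥-elim (¬p p)
        ... | _     | _     | no ¬q = ⊥-elim (¬q q)
        ... | yes _ | yes _ | yes _ = s≤s (s≤s z≤n)
        ... | no _  | yes _ | yes _ = s≤s z≤n

        count-∷-+ : ∀ x xs → count P? (x ∷ xs) + count Q? (x ∷ xs) ≡
          (indicator (P? x) + indicator (Q? x)) + (count P? xs + count Q? xs)
        count-∷-+ x xs rewrite count-∷ P? x xs | count-∷ Q? x xs =
          interchange (indicator (P? x)) (count P? xs) (indicator (Q? x)) (count Q? xs)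

      count-⊎-≤ : ∀ xs → count T? xs ≤ count P? xs + count Q? xs
      count-⊎-≤ [] = z≤n
      count-⊎-≤ (x ∷ xs) rewrite count-∷-+ x xs | count-∷ T? x xs =
        ℕₚ.+-mono-≤ (indicator-≤ x) (count-⊎-≤ xs)

      -- An element with both properties counts twice on the right and at most once on the left.
      count-⊎-< : ∀ {x xs} → x ∈ xs → P x → Q x → count T? xs < count P? xs + count Q? xs
      count-⊎-< {x} {_ ∷ xs} (here refl) px qx rewrite count-∷-+ x xs | count-∷ T? x xs =
        ℕₚ.+-mono-<-≤ (indicator-< x px qx) (count-⊎-≤ xs)
      count-⊎-< {x} {y ∷ xs} (there x∈) px qx rewrite count-∷-+ y xs | count-∷ T? y xs =
        ℕₚ.+-mono-≤-< (indicator-≤ y) (count-⊎-< x∈ px qx)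

  -- Monomials of given degree, and exponent vectors as edge sets.

  monos-complete : ∀ {N} (α : Mon N) → α ∈ monos N (deg α)
  monos-complete [] = here refl
  monos-complete {suc N} (k ∷ α) =
    ∈-concatMap⁺ (λ l → List.map (l ∷_) (monos N (k + deg α ∸ l)))
      (Any.map (λ { refl → ∈-map⁺ (k ∷_) (subst (λ j → α ∈ monos N j) (sym (ℕₚ.m+n∸m≡n k (deg α))) (monos-complete α)) })
        (∈-upTo⁺ (s≤s (ℕₚ.m≤m+n k (deg α)))))

  monos-unique : ∀ N j → Unique (monos N j)
  monos-unique zero    zero    = [] ∷ []
  monos-unique zero    (suc j) = []
  monos-unique (suc N) j = Uniqueₚ.concat⁺
    (Allₚ.map⁺ (All.universal (λ k → Uniqueₚ.map⁺ Vecₚ.∷-injectiveʳ (monos-unique N (j ∸ k))) (upTo (suc j))))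
    (AllPairsₚ.map⁺ (AllPairsₚ.applyUpTo⁺₁ (λ k → k) (suc j) disjoint))
    where
    disjoint : ∀ {k l} → k < l → l < suc j → ∀ {v} →
      v ∈ List.map (k ∷_) (monos N (j ∸ k)) × v ∈ List.map (l ∷_) (monos N (j ∸ l)) → ⊥
    disjoint k<l _ (v∈₁ , v∈₂) with ∈-map⁻ _ v∈₁ | ∈-map⁻ _ v∈₂
    ... | _ , _ , refl | _ , _ , eq = ℕₚ.<⇒≢ k<l (Vecₚ.∷-injectiveˡ eq)

  monos-deg : ∀ {N j} {α : Mon N} → α ∈ monos N j → deg α ≡ j
  monos-deg {zero}  {zero}  (here refl) = refl
  monos-deg {suc N} {j}     α∈
    with k , k∈ , α∈′ ← find (∈-concatMap⁻ (λ k → List.map (k ∷_) (monos N (j ∸ k))) {xs = upTo (suc j)} α∈)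
    with β , β∈ , refl ← ∈-map⁻ (k ∷_) α∈′ =
    trans (cong (k +_) (monos-deg β∈)) (ℕₚ.m+[n∸m]≡n (ℕₚ.≤-pred (∈-upTo⁻ k∈)))

  Vec-ext : ∀ {A : Set} {N} {u v : Vec A N} → (∀ i → lookup u i ≡ lookup v i) → u ≡ v
  Vec-ext {u = u} {v} eq = begin
    u                   ≡⟨ Vecₚ.tabulate∘lookup u ⟨
    tabulate (lookup u) ≡⟨ Vecₚ.tabulate-cong eq ⟩
    tabulate (lookup v) ≡⟨ Vecₚ.tabulate∘lookup v ⟩
    v                   ∎
    where open ≡-Reasoning

  module _ {N : ℕ} where

    unit : Fin N → Mon N
    unit i = replicate N 0 [ i ]≔ 1

    ZeroOne : Mon N → Set
    ZeroOne α = ∀ i → lookup α i ≤ 1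

  lookup-unit : ∀ {N} (i : Fin N) → lookup (unit i) i ≡ 1
  lookup-unit i = Vecₚ.lookup∘update i (replicate _ 0) 1

  lookup-unit-≢ : ∀ {N} {i j : Fin N} → j ≢ i → lookup (unit i) j ≡ 0
  lookup-unit-≢ {N} {i} {j} j≢i = trans (Vecₚ.lookup∘update′ j≢i (replicate N 0) 1) (Vecₚ.lookup-replicate j 0)

  deg-sum : ∀ {N} (α : Mon N) → deg α ≡ sum (lookup α)
  deg-sum []      = refl
  deg-sum (a ∷ α) = cong (a +_) (deg-sum α)

  deg-tabulate : ∀ {N} (f : Fin N → ℕ) → deg (tabulate f) ≡ sum f
  deg-tabulate {zero}  f = refl
  deg-tabulate {suc N} f = cong (f fzero +_) (deg-tabulate (λ i → f (fsuc i)))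

  deg-permute : ∀ {N} (α : Mon N) (τ : Fin N → Fin N) → (∀ i → τ (τ i) ≡ i) →
    deg (tabulate (λ i → lookup α (τ i))) ≡ deg α
  deg-permute α τ inv = trans (deg-tabulate (λ i → lookup α (τ i)))
    (trans (sym (sum-permute (lookup α) (permutation τ τ inv inv))) (sym (deg-sum α)))

  deg-replicate : ∀ N → deg (replicate N 0) ≡ 0
  deg-replicate zero    = refl
  deg-replicate (suc N) = deg-replicate N

  deg-zipWith : ∀ {N} (α β : Mon N) → deg (zipWith _+_ α β) ≡ deg α + deg β
  deg-zipWith []      []      = refl
  deg-zipWith (a ∷ α) (b ∷ β) rewrite deg-zipWith α β = interchange a b (deg α) (deg β)

  deg-≔1 : ∀ {N} (α : Mon N) i → lookup α i ≡ 0 → deg (α [ i ]≔ 1) ≡ suc (deg α)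
  deg-≔1 (_ ∷ α) fzero    refl = refl
  deg-≔1 (a ∷ α) (fsuc i) eq   = trans (cong (a +_) (deg-≔1 α i eq)) (ℕₚ.+-suc a (deg α))

  deg-unit : ∀ {N} (i : Fin N) → deg (unit i) ≡ 1
  deg-unit {N} i = trans (deg-≔1 (replicate N 0) i (Vecₚ.lookup-replicate i 0)) (cong suc (deg-replicate N))

  ≔-restore : ∀ {N} (α : Mon N) i {c} d → lookup α i ≡ c → (α [ i ]≔ d) [ i ]≔ c ≡ α
  ≔-restore α i d refl = trans (Vecₚ.[]≔-idempotent α i) (Vecₚ.[]≔-lookup α i)

  deg-≔0 : ∀ {N} (α : Mon N) i → lookup α i ≡ 1 → suc (deg (α [ i ]≔ 0)) ≡ deg α
  deg-≔0 α i eq = trans (sym (deg-≔1 (α [ i ]≔ 0) i (Vecₚ.lookup∘update i α 0))) (cong deg (≔-restore α i 0 eq))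

  unit-+ : ∀ {N} (α : Mon N) i → lookup α i ≡ 0 → zipWith _+_ (unit i) α ≡ α [ i ]≔ 1
  unit-+ {N} α i eq = Vec-ext λ j → trans (Vecₚ.lookup-zipWith _+_ j (unit i) α) (entry j)
    where
    entry : ∀ j → lookup (unit i) j + lookup α j ≡ lookup (α [ i ]≔ 1) j
    entry j with j Finₚ.≟ i
    ... | yes refl rewrite lookup-unit j | eq = sym (Vecₚ.lookup∘update j α 1)
    ... | no j≢i rewrite lookup-unit-≢ j≢i = sym (Vecₚ.lookup∘update′ j≢i α 1)

  ZeroOne-≔ : ∀ {N} (α : Mon N) i {c} → c ≤ 1 → ZeroOne α → ZeroOne (α [ i ]≔ c)
  ZeroOne-≔ α i {c} c≤1 z j with j Finₚ.≟ i
  ... | yes refl rewrite Vecₚ.lookup∘update i α c = c≤1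
  ... | no j≢i rewrite Vecₚ.lookup∘update′ j≢i α c = z j

  ≤1∧≢1⇒≡0 : ∀ {a} → a ≤ 1 → a ≢ 1 → a ≡ 0
  ≤1∧≢1⇒≡0 z≤n       _   = refl
  ≤1∧≢1⇒≡0 (s≤s z≤n) a≢1 = ⊥-elim (a≢1 refl)

  -- A connection using one extra edge {x , y} can be taken to cross it at most once.
  Star-cut : ∀ {V : Set} {R S : V → V → Set} {x y} →
    (∀ {u v} → R u v → S u v ⊎ (u ≡ x × v ≡ y) ⊎ (u ≡ y × v ≡ x)) →
    ∀ {u v} → Star R u v → Star S u v ⊎ (Star S u x × Star S y v) ⊎ (Star S u y × Star S x v)
  Star-cut cut ε = inj₁ ε
  Star-cut cut (r ◅ rs) with cut r | Star-cut cut rs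
  ... | inj₁ s                    | inj₁ p              = inj₁ (s ◅ p)
  ... | inj₁ s                    | inj₂ (inj₁ (p , q)) = inj₂ (inj₁ (s ◅ p , q))
  ... | inj₁ s                    | inj₂ (inj₂ (p , q)) = inj₂ (inj₂ (s ◅ p , q))
  ... | inj₂ (inj₁ (refl , refl)) | inj₁ p              = inj₂ (inj₁ (ε , p))
  ... | inj₂ (inj₁ (refl , refl)) | inj₂ (inj₁ (_ , q)) = inj₂ (inj₁ (ε , q))
  ... | inj₂ (inj₁ (refl , refl)) | inj₂ (inj₂ (_ , q)) = inj₁ q
  ... | inj₂ (inj₂ (refl , refl)) | inj₁ p              = inj₂ (inj₂ (ε , p))
  ... | inj₂ (inj₂ (refl , refl)) | inj₂ (inj₁ (_ , q)) = inj₁ q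
  ... | inj₂ (inj₂ (refl , refl)) | inj₂ (inj₂ (_ , q)) = inj₂ (inj₂ (ε , q))

  -- A multigraph on V with edges Fin N; a set of edges is the exponent vector α with support {i : α i = 1}.
  module Graph {V : Set} (_≟_ : DecidableEquality V) {N : ℕ} (src tgt : Fin N → V) where

    -- Connectivity, bridges and forests in a multigraph.

    Joins : Fin N → V → V → Set
    Joins i u v = (src i ≡ u × tgt i ≡ v) ⊎ (src i ≡ v × tgt i ≡ u)

    record Edge (α : Mon N) (u v : V) : Set where
      constructor via
      field
        index  : Fin N
        member : lookup α index ≡ 1
        joins  : Joins index u v

    Conn : Mon N → V → V → Set
    Conn α = Star (Edge α)

    -- Requiring every edge to be a bridge is easier to carry along than the absence of cycles: it
    -- passes to subsets, survives an edge added between two components, and is decidable once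
    -- connectivity is. Agreement with cycles is shown later for the bipartite graph.
    record Acyclic (α : Mon N) : Set where
      constructor acyclic
      field bridge : ∀ i → lookup α i ≡ 1 → ¬ Conn (α [ i ]≔ 0) (src i) (tgt i)
    open Acyclic

    Joins-sym : ∀ {i u v} → Joins i u v → Joins i v u
    Joins-sym (inj₁ j) = inj₂ j
    Joins-sym (inj₂ j) = inj₁ j

    Joins-ends : ∀ {i u v x y} → Joins i u v → Joins i x y → (u ≡ x × v ≡ y) ⊎ (u ≡ y × v ≡ x)
    Joins-ends (inj₁ (refl , refl)) (inj₁ (refl , refl)) = inj₁ (refl , refl)
    Joins-ends (inj₁ (refl , refl)) (inj₂ (refl , refl)) = inj₂ (refl , refl)
    Joins-ends (inj₂ (refl , refl)) (inj₁ (refl , refl)) = inj₂ (refl , refl)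
    Joins-ends (inj₂ (refl , refl)) (inj₂ (refl , refl)) = inj₁ (refl , refl)

    Edge-sym : ∀ {α} → Symmetric (Edge α)
    Edge-sym (via i i∈α j) = via i i∈α (Joins-sym j)

    Conn-sym : ∀ {α} → Symmetric (Conn α)
    Conn-sym = Star.reverse Edge-sym

    edge : ∀ {α i u v} → lookup α i ≡ 1 → Joins i u v → Conn α u v
    edge i∈α j = via _ i∈α j ◅ ε

    _⊑_ : Mon N → Mon N → Set
    α ⊑ β = ∀ i → lookup α i ≡ 1 → lookup β i ≡ 1

    Conn-mono : ∀ {α β} → α ⊑ β → ∀ {u v} → Conn α u v → Conn β u v
    Conn-mono α⊑β = Star.map λ (via i i∈α j) → via i (α⊑β i i∈α) j

    ≔0-⊑ : ∀ α i → (α [ i ]≔ 0) ⊑ α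
    ≔0-⊑ α i j j∈ with j Finₚ.≟ i
    ... | yes refl with () ← trans (sym (Vecₚ.lookup∘update i α 0)) j∈
    ... | no j≢i = trans (sym (Vecₚ.lookup∘update′ j≢i α 0)) j∈

    ⊑-≔1 : ∀ α i → α ⊑ (α [ i ]≔ 1)
    ⊑-≔1 α i j j∈ with j Finₚ.≟ i
    ... | yes refl = Vecₚ.lookup∘update i α 1
    ... | no j≢i = trans (Vecₚ.lookup∘update′ j≢i α 1) j∈

    ⊑-≔0 : ∀ {α β} i → α ⊑ β → (α [ i ]≔ 0) ⊑ (β [ i ]≔ 0)
    ⊑-≔0 {α} {β} i α⊑β j j∈ with j Finₚ.≟ i
    ... | yes refl with () ← trans (sym (Vecₚ.lookup∘update i α 0)) j∈
    ... | no j≢i = trans (Vecₚ.lookup∘update′ j≢i β 0) (α⊑β j (trans (sym (Vecₚ.lookup∘update′ j≢i α 0)) j∈))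

    Acyclic-⊑ : ∀ {α β} → α ⊑ β → Acyclic β → Acyclic α
    Acyclic-⊑ {α} {β} α⊑β acyc = acyclic λ i i∈α c →
      bridge acyc i (α⊑β i i∈α) (Conn-mono (⊑-≔0 {α} {β} i α⊑β) c)

    Conn-cut : ∀ {α} i {x y} → Joins i x y → ∀ {u v} → Conn α u v →
      let H = α [ i ]≔ 0 in Conn H u v ⊎ (Conn H u x × Conn H y v) ⊎ (Conn H u y × Conn H x v)
    Conn-cut {α} i {x} {y} ixy = Star-cut cut
      where
      cut : ∀ {u v} → Edge α u v → Edge (α [ i ]≔ 0) u v ⊎ (u ≡ x × v ≡ y) ⊎ (u ≡ y × v ≡ x)
      cut (via j j∈α juv) with j Finₚ.≟ i
      ... | yes refl = inj₂ (Joins-ends juv ixy)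
      ... | no j≢i = inj₁ (via j (trans (Vecₚ.lookup∘update′ j≢i α 0) j∈α) juv)

    Acyclic-bridge : ∀ {α i x y} → Acyclic α → lookup α i ≡ 1 → Joins i x y → ¬ Conn (α [ i ]≔ 0) x y
    Acyclic-bridge acyc i∈α (inj₁ (refl , refl)) c = bridge acyc _ i∈α c
    Acyclic-bridge acyc i∈α (inj₂ (refl , refl)) c = bridge acyc _ i∈α (Conn-sym c)

    -- Deleting the new edge i gives back α. If another edge j is deleted, a connection of its ends
    -- either avoids i, against acyclicity of α, or crosses i; in the latter case its two halves and
    -- j together join x to y in α.
    Acyclic-add : ∀ {α i x y} → lookup α i ≡ 0 → Joins i x y →
      Acyclic α → ¬ Conn α x y → Acyclic (α [ i ]≔ 1)
    bridge (Acyclic-add {α} {i} {x} {y} i∉α ixy acyc x≁y) j j∈ c with j Finₚ.≟ i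
    ... | yes refl = close ixy (subst (λ β → Conn β _ _) (≔-restore α i 1 i∉α) c)
      where
      close : Joins i x y → ¬ Conn α (src i) (tgt i)
      close (inj₁ (refl , refl)) c = x≁y c
      close (inj₂ (refl , refl)) c = x≁y (Conn-sym c)
    ... | no j≢i = split (subst cutIn without-i (Conn-cut i ixy c))
      where
      cutIn : Mon N → Set
      cutIn H = Conn H (src j) (tgt j) ⊎ (Conn H (src j) x × Conn H y (tgt j)) ⊎ (Conn H (src j) y × Conn H x (tgt j))
      without-i : ((α [ i ]≔ 1) [ j ]≔ 0) [ i ]≔ 0 ≡ α [ j ]≔ 0
      without-i = trans (Vecₚ.[]≔-commutes (α [ i ]≔ 1) j i j≢i) (cong (_[ j ]≔ 0) (≔-restore α i 1 i∉α))
      j∈α : lookup α j ≡ 1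
      j∈α = trans (sym (Vecₚ.lookup∘update′ j≢i α 1)) j∈
      up : ∀ {u v} → Conn (α [ j ]≔ 0) u v → Conn α u v
      up = Conn-mono (≔0-⊑ α j)
      split : ¬ cutIn (α [ j ]≔ 0)
      split (inj₁ p) = bridge acyc j j∈α p
      split (inj₂ (inj₁ (p , q))) = x≁y (Conn-sym (up p) ◅◅ edge j∈α (inj₁ (refl , refl)) ◅◅ Conn-sym (up q))
      split (inj₂ (inj₂ (p , q))) = x≁y (up q ◅◅ edge j∈α (inj₂ (refl , refl)) ◅◅ up p)

    abstract
      -- Induction on a list of admissible edges: by `Star-cut`, a connection that may use one more
      -- edge reduces to connections that do not, possibly two of them ending at the two ends of
      -- that edge.
      conn? : ∀ α u v → Dec (Conn α u v)
      conn? α u v = map′ (Star.map from) (Star.map to) (among (List.allFin N) u v)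
        where
        open import Data.List.Membership.Propositional.Properties using (∈-allFin)
        Among : List (Fin N) → V → V → Set
        Among is u v = ∃ λ i → i ∈ is × lookup α i ≡ 1 × Joins i u v
        from : ∀ {u v} → Among (List.allFin N) u v → Edge α u v
        from (i , _ , i∈α , j) = via i i∈α j
        to : ∀ {u v} → Edge α u v → Among (List.allFin N) u v
        to (via i i∈α j) = i , ∈-allFin i , i∈α , j
        weaken : ∀ {i is u v} → Among is u v → Among (i ∷ is) u v
        weaken (j , j∈ , e) = j , there j∈ , e
        among : ∀ is u v → Dec (Star (Among is) u v)
        among [] u v = map′ (λ { refl → ε }) (λ { ε → refl ; ((_ , () , _) ◅ _) }) (u ≟ v)
        among (i ∷ is) u v with lookup α i ℕ.≟ 1
        ... | no i∉α = map′ (Star.map weaken) (Star.map strip) (among is u v)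
          where
          strip : ∀ {u v} → Among (i ∷ is) u v → Among is u v
          strip (j , here refl , i∈α , _) = ⊥-elim (i∉α i∈α)
          strip (j , there j∈ , e) = j , j∈ , e
        ... | yes i∈α = map′ glue (Star-cut cut)
                (among is u v ⊎-dec (among is u (src i) ×-dec among is (tgt i) v) ⊎-dec (among is u (tgt i) ×-dec among is (src i) v))
          where
          glue : Star (Among is) u v ⊎ (Star (Among is) u (src i) × Star (Among is) (tgt i) v) ⊎
            (Star (Among is) u (tgt i) × Star (Among is) (src i) v) → Star (Among (i ∷ is)) u v
          glue (inj₁ p) = Star.map weaken p
          glue (inj₂ (inj₁ (p , q))) = Star.map weaken p ◅◅ (i , here refl , i∈α , inj₁ (refl , refl)) ◅ Star.map weaken q
          glue (inj₂ (inj₂ (p , q))) = Star.map weaken p ◅◅ (i , here refl , i∈α , inj₂ (refl , refl)) ◅ Star.map weaken q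
          cut : ∀ {u v} → Among (i ∷ is) u v → Among is u v ⊎ (u ≡ src i × v ≡ tgt i) ⊎ (u ≡ tgt i × v ≡ src i)
          cut (j , there j∈ , e) = inj₁ (j , j∈ , e)
          cut (j , here refl , _ , inj₁ (refl , refl)) = inj₂ (inj₁ (refl , refl))
          cut (j , here refl , _ , inj₂ (refl , refl)) = inj₂ (inj₂ (refl , refl))

    abstract
      acyclic? : ∀ α → Dec (Acyclic α)
      acyclic? α = map′ acyclic bridge
        (Finₚ.all? λ i → (lookup α i ℕ.≟ 1) →-dec ¬? (conn? (α [ i ]≔ 0) (src i) (tgt i)))

    record Forest (k : ℕ) (α : Mon N) : Set where
      constructor forest
      field
        zeroOne : ZeroOne α
        degree  : deg α ≡ k
        acycle  : Acyclic α

    abstract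
      forest? : ∀ k → Decidable (Forest k)
      forest? k α = map′ (λ (z , d , a) → forest z d a) (λ (forest z d a) → z , d , a)
        (Finₚ.all? (λ i → lookup α i ℕ.≤? 1) ×-dec (deg α ℕ.≟ k) ×-dec acyclic? α)

    -- Forests that contain one edge and separate two vertices.

    record Separating (k : ℕ) (e : Fin N) (u v : V) (α : Mon N) : Set where
      constructor separating
      field
        isForest : Forest k α
        contains : lookup α e ≡ 1
        apart    : ¬ Conn α u v

    abstract
      separating? : ∀ k e u v → Decidable (Separating k e u v)
      separating? k e u v α = map′ (λ (f , e∈ , a) → separating f e∈ a) (λ (separating f e∈ a) → f , e∈ , a)
        (forest? k α ×-dec (lookup α e ℕ.≟ 1) ×-dec ¬? (conn? α u v))

    ♯ : ℕ → Fin N → V → V → ℕ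
    ♯ k e u v = count (separating? k e u v) (monos N k)

    Forest-∈ : ∀ {k α} → Forest k α → α ∈ monos N k
    Forest-∈ {α = α} (forest _ refl _) = monos-complete α

    ♯-sym : ∀ k e u v → ♯ k e u v ≤ ♯ k e v u
    ♯-sym k e u v = count-≤-via (separating? k e u v) (separating? k e v u) _≡_ (monos-unique N k)
      (λ {α} (separating f e∈α u≁v) → α , Forest-∈ f , separating f e∈α (λ c → u≁v (Conn-sym c)) , refl)
      (λ { refl refl → refl })

    ♯-joined : ∀ k e → ♯ k e (src e) (tgt e) ≡ 0
    ♯-joined k e = cong List.length (filter-none (separating? k e (src e) (tgt e))
      (All.universal (λ _ (separating _ e∈α s≁t) → s≁t (edge e∈α (inj₁ (refl , refl)))) (monos N k)))

    -- The edge e would link connections of x′ to z and of x to y into one of x′ to y. Strictness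
    -- comes from the forest γ, which both terms on the right count.
    ♯-triangle : ∀ k {e x x′ y z γ} → Joins e x z → Separating k e x y γ → Separating k e x′ z γ →
      ♯ k e x′ y < ♯ k e x y + ♯ k e x′ z
    ♯-triangle k {e} {x} {x′} {y} {z} exz sep₁ sep₂ =
      count-⊎-< (separating? k e x y) (separating? k e x′ z) (separating? k e x′ y) split
        (Forest-∈ (Separating.isForest sep₁)) sep₁ sep₂
      where
      split : ∀ {α} → Separating k e x′ y α → Separating k e x y α ⊎ Separating k e x′ z α
      split {α} (separating f e∈α x′≁y) with conn? α x y
      ... | no x≁y = inj₁ (separating f e∈α x≁y)
      ... | yes x~y = inj₂ (separating f e∈α λ x′~z → x′≁y (x′~z ◅◅ edge e∈α (Joins-sym exz) ◅◅ x~y))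

    -- Graph automorphisms equal to their own inverse, so that a single inequality between counts,
    -- applied twice, gives equality. The transpositions of two left or two right vertices are of
    -- this kind.
    record Involution : Set where
      field
        τ    : Fin N → Fin N
        ρ    : V → V
        τ-τ  : ∀ i → τ (τ i) ≡ i
        ρ-ρ  : ∀ v → ρ (ρ v) ≡ v
        srcτ : ∀ i → src (τ i) ≡ ρ (src i)
        tgtτ : ∀ i → tgt (τ i) ≡ ρ (tgt i)

      Joins-τ : ∀ {i u v} → Joins i u v → Joins (τ i) (ρ u) (ρ v)
      Joins-τ {i} (inj₁ (refl , refl)) = inj₁ (srcτ i , tgtτ i)
      Joins-τ {i} (inj₂ (refl , refl)) = inj₂ (srcτ i , tgtτ i)

      act : Mon N → Mon N
      act α = tabulate (λ i → lookup α (τ i))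

      lookup-act : ∀ α i → lookup (act α) i ≡ lookup α (τ i)
      lookup-act α = Vecₚ.lookup∘tabulate (λ i → lookup α (τ i))

      act-act : ∀ α → act (act α) ≡ α
      act-act α = Vec-ext λ i → trans (lookup-act (act α) i) (trans (lookup-act α (τ i)) (cong (lookup α) (τ-τ i)))

      lookup-act-τ : ∀ α i → lookup (act α) (τ i) ≡ lookup α i
      lookup-act-τ α i = trans (lookup-act α (τ i)) (cong (lookup α) (τ-τ i))

      Conn-act : ∀ {α u v} → Conn α u v → Conn (act α) (ρ u) (ρ v)
      Conn-act {α} = Star.gmap ρ λ (via i i∈α j) → via (τ i) (trans (lookup-act-τ α i) i∈α) (Joins-τ j)

      act-≔0 : ∀ α i → act (α [ i ]≔ 0) ≡ act α [ τ i ]≔ 0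
      act-≔0 α i = Vec-ext λ j → trans (lookup-act (α [ i ]≔ 0) j) (entry j)
        where
        entry : ∀ j → lookup (α [ i ]≔ 0) (τ j) ≡ lookup (act α [ τ i ]≔ 0) j
        entry j with j Finₚ.≟ τ i
        ... | yes refl rewrite τ-τ i | Vecₚ.lookup∘update i α 0 = sym (Vecₚ.lookup∘update (τ i) (act α) 0)
        ... | no j≢τi = trans (Vecₚ.lookup∘update′ (λ { refl → j≢τi (sym (τ-τ j)) }) α 0)
                (trans (sym (lookup-act α j)) (sym (Vecₚ.lookup∘update′ j≢τi (act α) 0)))

      Acyclic-act : ∀ {α} → Acyclic α → Acyclic (act α)
      Acyclic-act {α} acyc = acyclic λ i i∈ c → bridge acyc (τ i) (trans (sym (lookup-act α i)) i∈)
        (subst (λ β → Conn β _ _) (trans (act-≔0 (act α) i) (cong (_[ τ i ]≔ 0) (act-act α)))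
          (subst₂ (Conn (act (act α [ i ]≔ 0))) (sym (srcτ i)) (sym (tgtτ i)) (Conn-act c)))

      Forest-act : ∀ {k α} → Forest k α → Forest k (act α)
      Forest-act {α = α} (forest z d acyc) = forest
        (λ i → subst (_≤ 1) (sym (lookup-act α i)) (z (τ i))) (trans (deg-permute α τ τ-τ) d) (Acyclic-act acyc)

      ♯-act-≤ : ∀ k e u v → ♯ k e u v ≤ ♯ k (τ e) (ρ u) (ρ v)
      ♯-act-≤ k e u v = count-≤-via (separating? k e u v) (separating? k (τ e) (ρ u) (ρ v)) (λ α β → β ≡ act α)
        (monos-unique N k)
        (λ {α} (separating f e∈α u≁v) → act α , Forest-∈ (Forest-act f) ,
          (separating (Forest-act f) (trans (lookup-act-τ α e) e∈α)
            λ c → u≁v (subst₂ (Conn α) (ρ-ρ u) (ρ-ρ v) (subst (λ β → Conn β _ _) (act-act α) (Conn-act c)))) , refl)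
        (λ {α} {α′} eq eq′ → trans (sym (act-act α)) (trans (cong act (trans (sym eq) eq′)) (act-act α′)))

      ♯-act : ∀ k e u v → ♯ k e u v ≡ ♯ k (τ e) (ρ u) (ρ v)
      ♯-act k e u v = ℕₚ.≤-antisym (♯-act-≤ k e u v)
        (subst (♯ k (τ e) (ρ u) (ρ v) ≤_) back (♯-act-≤ k (τ e) (ρ u) (ρ v)))
        where
        back : ♯ k (τ (τ e)) (ρ (ρ u)) (ρ (ρ v)) ≡ ♯ k e u v
        back rewrite τ-τ e | ρ-ρ u | ρ-ρ v = refl

    -- An edge of α joins its own ends, so separation of the ends of f says both that f is new,
    -- which keeps the exponents at most 1, and that f closes no cycle.
    Forest-unit-+⁺ : ∀ {k α f} → Forest k α → ¬ Conn α (src f) (tgt f) → Forest (suc k) (zipWith _+_ (unit f) α)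
    Forest-unit-+⁺ {k} {α} {f} (forest z d acyc) s≁t = subst (Forest (suc k)) (sym (unit-+ α f f∉α))
      (forest (ZeroOne-≔ α f ≤-refl z) (trans (deg-≔1 α f f∉α) (cong suc d)) (Acyclic-add f∉α joins acyc s≁t))
      where
      joins : Joins f (src f) (tgt f)
      joins = inj₁ (refl , refl)
      f∉α : lookup α f ≡ 0
      f∉α = ≤1∧≢1⇒≡0 (z f) λ f∈α → s≁t (edge f∈α joins)

    Forest-unit-+⁻ : ∀ {k α f} → Forest (suc k) (zipWith _+_ (unit f) α) → Forest k α × ¬ Conn α (src f) (tgt f)
    Forest-unit-+⁻ {k} {α} {f} F = forest z d (Acyclic-⊑ (⊑-≔1 α f) acyc) ,
      λ c → bridge acyc f (Vecₚ.lookup∘update f α 1) (subst (λ β → Conn β _ _) (sym (≔-restore α f 1 f∉α)) c)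
      where
      entries : ∀ i → lookup (unit f) i + lookup α i ≤ 1
      entries i = subst (_≤ 1) (Vecₚ.lookup-zipWith _+_ i (unit f) α) (Forest.zeroOne F i)
      z : ZeroOne α
      z i = ≤-trans (ℕₚ.m≤n+m (lookup α i) (lookup (unit f) i)) (entries i)
      f∉α : lookup α f ≡ 0
      f∉α = ℕₚ.n≤0⇒n≡0 (ℕₚ.≤-pred (subst (λ x → x + lookup α f ≤ 1) (lookup-unit f) (entries f)))
      d : deg α ≡ k
      d = ℕₚ.suc-injective (trans (cong (_+ deg α) (sym (deg-unit f))) (trans (sym (deg-zipWith (unit f) α)) (Forest.degree F)))
      acyc : Acyclic (α [ f ]≔ 1)
      acyc = subst Acyclic (unit-+ α f f∉α) (Forest.acycle F)

    -- The connection is cut at its last visit to x: the next edge g leaves x, and the remainder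
    -- never meets x again, hence does not use g.
    first-edge : ∀ {α x y} → x ≢ y → Conn α x y →
      ∃ λ g → ∃ λ c → lookup α g ≡ 1 × Joins g x c × Conn (α [ g ]≔ 0) c y
    first-edge {α} {x} {y} x≢y x~y =
      [ (λ p → ⊥-elim (stuck p x≢y))
      , (λ (g , c , g∈α , gxc , p) → g , c , g∈α , gxc , Star.map (relax g gxc) p)
      ]′ (last-exit x~y)
      where
      Avoid : V → V → Set
      Avoid u v = Edge α u v × u ≢ x × v ≢ x
      Exit : Set
      Exit = ∃ λ g → ∃ λ c → lookup α g ≡ 1 × Joins g x c × Star Avoid c y
      stuck : ∀ {y} → Star Avoid x y → ¬ x ≢ y
      stuck ε x≢y = x≢y refl
      stuck ((_ , x≢x , _) ◅ _) _ = x≢x refl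
      last-exit : ∀ {u} → Conn α u y → Star Avoid u y ⊎ Exit
      last-exit ε = inj₁ ε
      last-exit {u} (_◅_ {j = w} e es) with last-exit es
      ... | inj₂ exit = inj₂ exit
      ... | inj₁ p with u ≟ x | w ≟ x
      ...   | yes refl | _        = let via i i∈α iuw = e in inj₂ (i , w , i∈α , iuw , p)
      ...   | no _     | yes refl = ⊥-elim (stuck p x≢y)
      ...   | no u≢x   | no w≢x   = inj₁ ((e , u≢x , w≢x) ◅ p)
      avoids : ∀ {g c u v} → Joins g x c → Joins g u v → u ≢ x → v ≢ x → ⊥
      avoids (inj₁ (refl , _)) (inj₁ (refl , _)) u≢x _ = u≢x refl
      avoids (inj₁ (refl , _)) (inj₂ (refl , _)) _ v≢x = v≢x refl
      avoids (inj₂ (_ , refl)) (inj₁ (_ , refl)) _ v≢x = v≢x refl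
      avoids (inj₂ (_ , refl)) (inj₂ (_ , refl)) u≢x _ = u≢x refl
      relax : ∀ g {c} → Joins g x c → ∀ {u v} → Avoid u v → Edge (α [ g ]≔ 0) u v
      relax g gxc (via i i∈α iuv , u≢x , v≢x) with i Finₚ.≟ g
      ... | yes refl = ⊥-elim (avoids gxc iuv u≢x v≢x)
      ... | no i≢g = via i (trans (Vecₚ.lookup∘update′ i≢g α 0) i∈α) iuv

    -- No side is singled out: two left vertices x, x′ will give p ≤ s and two right ones q ≤ s. The
    -- automorphism `inv` interchanges x and x′, so the moved edge is the image of the old one and
    -- can be moved back.
    module Exchange (inv : Involution) {x x′ y : V} {e : Fin N} {z : V}
      (ρx′ : Involution.ρ inv x′ ≡ x) (ρ-fix : ∀ {v} → v ≢ x → v ≢ x′ → Involution.ρ inv v ≡ v)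
      (loopless : ∀ i {v} → ¬ Joins i v v) (x′≢y : x′ ≢ y) (exz : Joins e x z) (x≢x′ : x ≢ x′) where

      open Involution inv

      -- If x is separated from y but x′ ~ y, the edge g = {x′ , c} of α leading from x′ towards y is
      -- replaced by h = τ g = {x , c}; then β joins x to y, separates x′ from y, and h is recovered
      -- as the edge leading from x towards y.
      record Switch (α β : Mon N) : Set where
        field
          {h}  : Fin N
          {c}  : V
          h∈β  : lookup β h ≡ 1
          hxc  : Joins h x c
          x≁y  : ¬ Conn (β [ h ]≔ 0) x y
          c~y  : Conn (β [ h ]≔ 0) c y
          acyc : Acyclic β
          α≡   : α ≡ (β [ h ]≔ 0) [ τ h ]≔ 1

      Related : Mon N → Mon N → Set
      Related α β = (α ≡ β × ¬ Conn β x y) ⊎ Switch α β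

      Switch-conn : ∀ {α β} → Switch α β → Conn β x y
      Switch-conn {β = β} s = edge h∈β hxc ◅◅ Conn-mono (≔0-⊑ β h) c~y where open Switch s

      -- The alternatives exclude each other, since β joins x to y only after a switch. For two
      -- switches with h ≠ h′, the connection of c′ to y is cut at h: each case either joins x to y
      -- without h or closes a cycle through h′.
      related-unique : ∀ {α α′ β} → Related α β → Related α′ β → α ≡ α′
      related-unique (inj₁ (refl , _)) (inj₁ (refl , _)) = refl
      related-unique (inj₁ (_ , x≁y)) (inj₂ s) = ⊥-elim (x≁y (Switch-conn s))
      related-unique (inj₂ s) (inj₁ (_ , x≁y)) = ⊥-elim (x≁y (Switch-conn s))
      related-unique {β = β} (inj₂ s) (inj₂ s′) with Switch.h s Finₚ.≟ Switch.h s′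
      ... | yes refl = trans (Switch.α≡ s) (sym (Switch.α≡ s′))
      ... | no h≢h′ = ⊥-elim (clash (Conn-cut S.h S.hxc S′.c~y))
        where
        module S = Switch s
        module S′ = Switch s′
        J = (β [ S′.h ]≔ 0) [ S.h ]≔ 0
        J⊑′ : J ⊑ (β [ S′.h ]≔ 0)
        J⊑′ = ≔0-⊑ (β [ S′.h ]≔ 0) S.h
        J⊑ : J ⊑ (β [ S.h ]≔ 0)
        J⊑ = ⊑-≔0 {β [ S′.h ]≔ 0} {β} S.h (≔0-⊑ β S′.h)
        h′∈ : lookup (β [ S.h ]≔ 0) S′.h ≡ 1
        h′∈ = trans (Vecₚ.lookup∘update′ (λ eq → h≢h′ (sym eq)) β 0) S′.h∈β
        clash : ¬ (Conn J S′.c y ⊎ (Conn J S′.c x × Conn J S.c y) ⊎ (Conn J S′.c S.c × Conn J x y))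
        clash (inj₁ p) = S.x≁y (edge h′∈ S′.hxc ◅◅ Conn-mono J⊑ p)
        clash (inj₂ (inj₁ (p , _))) = Acyclic-bridge S′.acyc S′.h∈β S′.hxc (Conn-sym (Conn-mono J⊑′ p))
        clash (inj₂ (inj₂ (_ , p))) = S.x≁y (Conn-mono J⊑ p)

      related-total : ∀ {k α} → Separating k e x y α →
        ∃ λ β → β ∈ monos N k × Separating k e x′ y β × Related α β
      related-total {k} {α} (separating f@(forest zo d acyc) e∈α x≁y) with conn? α x′ y
      ... | no x′≁y = α , Forest-∈ f , separating f e∈α x′≁y , inj₁ (refl , x≁y)
      ... | yes x′~y with g , c , g∈α , gx′c , c~y ← first-edge x′≢y x′~y =
          β , Forest-∈ fβ , separating fβ e∈β x′≁βy , inj₂ switch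
        where
        H = α [ g ]≔ 0
        h = τ g
        β = H [ h ]≔ 1
        up : ∀ {u v} → Conn H u v → Conn α u v
        up = Conn-mono (≔0-⊑ α g)
        c≢x : c ≢ x
        c≢x refl = x≁y (up c~y)
        c≢x′ : c ≢ x′
        c≢x′ refl = loopless g gx′c
        hxc : Joins h x c
        hxc = subst₂ (Joins h) ρx′ (ρ-fix c≢x c≢x′) (Joins-τ gx′c)
        x≁Hy : ¬ Conn H x y
        x≁Hy p = x≁y (up p)
        x≁Hc : ¬ Conn H x c
        x≁Hc p = x≁Hy (p ◅◅ c~y)
        x′≁Hc : ¬ Conn H x′ c
        x′≁Hc = Acyclic-bridge acyc g∈α gx′c
        zoH : ZeroOne H
        zoH = ZeroOne-≔ α g z≤n zo
        -- The edge h is new: otherwise x would reach c, and from there y, inside α.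
        h∉H : lookup H h ≡ 0
        h∉H = ≤1∧≢1⇒≡0 (zoH h) λ h∈H → x≁Hc (edge {H} h∈H hxc)
        acycβ : Acyclic β
        acycβ = Acyclic-add h∉H hxc (Acyclic-⊑ (≔0-⊑ α g) acyc) x≁Hc
        fβ : Forest k β
        fβ = forest (ZeroOne-≔ H h ≤-refl zoH) (trans (deg-≔1 H h h∉H) (trans (deg-≔0 α g g∈α) d)) acycβ
        -- The edge e survives the removal of g: it meets x, while both ends x′ and c of g differ
        -- from x.
        apart : ∀ {i} → Joins i x z → ¬ Joins i x′ c
        apart (inj₁ (refl , _)) (inj₁ (eq , _)) = x≢x′ eq
        apart (inj₁ (refl , _)) (inj₂ (eq , _)) = c≢x (sym eq)
        apart (inj₂ (_ , refl)) (inj₁ (_ , eq)) = c≢x (sym eq)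
        apart (inj₂ (_ , refl)) (inj₂ (_ , eq)) = x≢x′ eq
        e∈H : lookup H e ≡ 1
        e∈H = trans (Vecₚ.lookup∘update′ (λ { refl → apart exz gx′c }) α 0) e∈α
        e∈β : lookup β e ≡ 1
        e∈β = ⊑-≔1 H h e e∈H
        β-h : β [ h ]≔ 0 ≡ H
        β-h = ≔-restore H h 1 h∉H
        back : ∀ {u v} → Conn (β [ h ]≔ 0) u v → Conn H u v
        back = subst (λ δ → Conn δ _ _) β-h
        -- In H the vertex y lies with c, which the removal of g cut off from x′; nor does x′ lie
        -- with x, because x′ ~ y in α. So a connection can neither avoid h nor enter it at either
        -- end.
        x′≁βy : ¬ Conn β x′ y
        x′≁βy p with Conn-cut h hxc p
        ... | inj₁ q = x′≁Hc (back q ◅◅ Conn-sym c~y)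
        ... | inj₂ (inj₁ (q , _)) = x≁y (Conn-sym (up (back q)) ◅◅ x′~y)
        ... | inj₂ (inj₂ (q , _)) = x′≁Hc (back q)
        switch : Switch α β
        switch = record
          { h∈β = Vecₚ.lookup∘update h H 1 ; hxc = hxc
          ; x≁y = subst (λ δ → ¬ Conn δ x y) (sym β-h) x≁Hy
          ; c~y = subst (λ δ → Conn δ c y) (sym β-h) c~y
          ; acyc = acycβ
          ; α≡ = begin
              α                         ≡⟨ ≔-restore α g 0 g∈α ⟨
              H [ g ]≔ 1                ≡⟨ cong₂ (λ δ i → δ [ i ]≔ 1) β-h (τ-τ g) ⟨
              (β [ h ]≔ 0) [ τ h ]≔ 1   ∎ }
          where open ≡-Reasoning

      ♯-exchange : ∀ k → ♯ k e x y ≤ ♯ k e x′ y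
      ♯-exchange k = count-≤-via (separating? k e x y) (separating? k e x′ y) Related (monos-unique N k)
        related-total related-unique

  -- Simple paths.

  module SimplePaths {V : Set} (_≟_ : DecidableEquality V) (R : V → V → Set) where

    -- Each step stores that its start does not recur, which refers to `at` and forces the mutual
    -- definition. The length index presents the vertices as a family over `Fin`, the form in which
    -- `HasCycle` wants them.
    data Path : V → V → ℕ → Set
    at : ∀ {u v k} → Path u v k → Fin (suc k) → V

    data Path where
      []  : ∀ {u} → Path u u 0
      _∷_ : ∀ {u w v k} → R u w → (Σ (Path w v k) λ p → ∀ i → at p i ≢ u) → Path u v (suc k)

    at {u} _             fzero    = u
    at     (_ ∷ (p , _)) (fsuc i) = at p i

    at-last : ∀ {u v k} (p : Path u v k) → at p (fromℕ k) ≡ v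
    at-last []            = refl
    at-last (_ ∷ (p , _)) = at-last p

    at-injective : ∀ {u v k} (p : Path u v k) → Injective _≡_ _≡_ (at p)
    at-injective p                 {fzero}  {fzero}  _  = refl
    at-injective (_ ∷ (p , fresh)) {fzero}  {fsuc j} eq = ⊥-elim (fresh j (sym eq))
    at-injective (_ ∷ (p , fresh)) {fsuc i} {fzero}  eq = ⊥-elim (fresh i eq)
    at-injective (_ ∷ (p , _))     {fsuc i} {fsuc j} eq = cong fsuc (at-injective p eq)

    at-step : ∀ {u v k} (p : Path u v k) (i : Fin k) → R (at p (inject₁ i)) (at p (fsuc i))
    at-step (r ∷ (p , _)) fzero    = r
    at-step (r ∷ (p , _)) (fsuc i) = at-step p i

    suffix : ∀ {u v k} (p : Path u v k) (i : Fin (suc k)) → ∃ (Path (at p i) v)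
    suffix p             fzero    = _ , p
    suffix (_ ∷ (p , _)) (fsuc i) = suffix p i

    -- If u recurs on the simplified remainder, the loop is dropped by starting at that occurrence.
    simplify : ∀ {u v} → Star R u v → ∃ (Path u v)
    simplify ε = 0 , []
    simplify {u} (r ◅ rs) with simplify rs
    ... | k , p with Finₚ.any? (λ i → at p i ≟ u)
    ...   | yes (i , refl) = suffix p i
    ...   | no fresh       = suc k , r ∷ (p , λ i eq → fresh (i , eq))

  -- Transpositions and functions of two arguments invariant under them.

  swap : ∀ {n} → Fin n → Fin n → Fin n → Fin n
  swap x y z with z Finₚ.≟ x | z Finₚ.≟ y
  ... | yes _ | _     = y
  ... | no _  | yes _ = x
  ... | no _  | no _  = z

  module _ {n : ℕ} (x y : Fin n) where

    swap-left : swap x y x ≡ y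
    swap-left with x Finₚ.≟ x
    ... | yes _   = refl
    ... | no x≢x  = ⊥-elim (x≢x refl)

    swap-right : swap x y y ≡ x
    swap-right with y Finₚ.≟ x | y Finₚ.≟ y
    ... | yes refl | _     = refl
    ... | no _     | yes _ = refl
    ... | no _     | no y≢y = ⊥-elim (y≢y refl)

    swap-other : ∀ {z} → z ≢ x → z ≢ y → swap x y z ≡ z
    swap-other {z} z≢x z≢y with z Finₚ.≟ x | z Finₚ.≟ y
    ... | yes eq | _      = ⊥-elim (z≢x eq)
    ... | no _   | yes eq = ⊥-elim (z≢y eq)
    ... | no _   | no _   = refl

    swap-involutive : ∀ z → swap x y (swap x y z) ≡ z
    swap-involutive z with z Finₚ.≟ x | z Finₚ.≟ y
    ... | yes refl | _        = swap-right
    ... | no _     | yes refl = swap-left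
    ... | no z≢x   | no z≢y   = swap-other z≢x z≢y

    swap-≢ : ∀ {u v} → u ≢ v → swap x y u ≢ swap x y v
    swap-≢ {u} {v} u≢v eq = u≢v (trans (sym (swap-involutive u)) (trans (cong (swap x y) eq) (swap-involutive v)))

  module SwapInvariant {A : Set} {n : ℕ} (f : Fin n → Fin n → A)
    (inv : ∀ x y u v → f u v ≡ f (swap x y u) (swap x y v)) where

    diagonal : ∀ x o → f x x ≡ f o o
    diagonal x o = subst (λ z → f x x ≡ f z z) (swap-left x o) (inv x o x x)

    -- One transposition carries x to o, a second carries the image y′ of y to l. The second fixes
    -- o, since y′ and l both differ from o.
    off-diagonal : ∀ {x y o l} → x ≢ y → o ≢ l → f x y ≡ f o l
    off-diagonal {x} {y} {o} {l} x≢y o≢l = begin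
      f x y                    ≡⟨ inv x o x y ⟩
      f (swap x o x) y′        ≡⟨ cong (λ z → f z y′) (swap-left x o) ⟩
      f o y′                   ≡⟨ inv y′ l o y′ ⟩
      f (swap y′ l o) (swap y′ l y′) ≡⟨ cong₂ f (swap-other y′ l o≢y′ o≢l) (swap-left y′ l) ⟩
      f o l                    ∎
      where
      open ≡-Reasoning
      y′ = swap x o y
      o≢y′ : o ≢ y′
      o≢y′ eq = swap-≢ x o x≢y (trans (swap-left x o) eq)

  -- The complete bipartite graph: its forests and its symmetries.

  module CompleteBipartite (m n : ℕ) where

    open Bip m n using (V; Adj; HasCycle; IsForest; IsBasisMon)

    _≟ᵛ_ : DecidableEquality V
    _≟ᵛ_ = Sumₚ.≡-dec Finₚ._≟_ Finₚ._≟_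

    left : Fin (m * n) → Fin m
    left = quotient n

    right : Fin (m * n) → Fin n
    right = remainder {m} n

    src tgt : Fin (m * n) → V
    src i = inj₁ (left i)
    tgt i = inj₂ (right i)

    open Graph _≟ᵛ_ src tgt public

    left-combine : ∀ (a : Fin m) (b : Fin n) → left (combine a b) ≡ a
    left-combine a b = cong proj₁ (Finₚ.remQuot-combine a b)

    right-combine : ∀ (a : Fin m) (b : Fin n) → right (combine a b) ≡ b
    right-combine a b = cong proj₂ (Finₚ.remQuot-combine a b)

    combine-left-right : ∀ i → combine (left i) (right i) ≡ i
    combine-left-right = Finₚ.combine-remQuot {m} n

    Joins-combine : ∀ a b → Joins (combine a b) (inj₁ a) (inj₂ b)
    Joins-combine a b = inj₁ (cong inj₁ (left-combine a b) , cong inj₂ (right-combine a b))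

    Joins-unique : ∀ {i j u v} → Joins i u v → Joins j u v → i ≡ j
    Joins-unique {i} {j} p q = trans (sym (combine-left-right i))
      (trans (uncurry′ (cong₂ combine) (ends p q)) (combine-left-right j))
      where
      open import Data.Product using (uncurry′)
      ends : ∀ {u v} → Joins i u v → Joins j u v → left i ≡ left j × right i ≡ right j
      ends (inj₁ (s , t)) (inj₁ (s′ , t′)) = Sumₚ.inj₁-injective (trans s (sym s′)) , Sumₚ.inj₂-injective (trans t (sym t′))
      ends (inj₂ (s , t)) (inj₂ (s′ , t′)) = Sumₚ.inj₁-injective (trans s (sym s′)) , Sumₚ.inj₂-injective (trans t (sym t′))
      ends (inj₁ (refl , _)) (inj₂ (_ , ()))
      ends (inj₂ (_ , refl)) (inj₁ (() , _))

    loopless : ∀ i {v} → ¬ Joins i v v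
    loopless i (inj₁ (refl , ()))
    loopless i (inj₂ (refl , ()))

    Adj⇒Edge : ∀ {α} u v → Adj α u v → Edge α u v
    Adj⇒Edge (inj₁ a) (inj₂ b) ab∈α = via (combine a b) ab∈α (Joins-combine a b)
    Adj⇒Edge (inj₂ b) (inj₁ a) ab∈α = via (combine a b) ab∈α (Joins-sym (Joins-combine a b))

    Edge⇒Adj : ∀ {α u v} → Edge α u v → Adj α u v
    Edge⇒Adj {α} (via i i∈α (inj₁ (refl , refl))) = trans (cong (lookup α) (combine-left-right i)) i∈α
    Edge⇒Adj {α} (via i i∈α (inj₂ (refl , refl))) = trans (cong (lookup α) (combine-left-right i)) i∈α

    -- The closing edge of a cycle is no bridge: the other edges still walk from one of its ends to
    -- the other.
    HasCycle⇒¬Acyclic : ∀ {α} → HasCycle α → ¬ Acyclic α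
    HasCycle⇒¬Acyclic {α} (k , v , v-inj , step , close) acyc
      with via i i∈α closing ← Adj⇒Edge {α} (v (fromℕ (suc (suc k)))) (v fzero) close =
      Acyclic-bridge acyc i∈α closing (Conn-sym (walk (suc (suc k)) v step′))
      where
      not-closing : ∀ j → ¬ Joins i (v (inject₁ j)) (v (fsuc j))
      not-closing j joins with Joins-ends joins closing
      ... | inj₁ (eq , _) = Finₚ.fromℕ≢inject₁ (sym (v-inj eq))
      -- Read backwards, the closing edge would be a step from the first vertex directly to the
      -- last, impossible with at least three vertices.
      ... | inj₂ (eq , eq′) with j | v-inj eq | v-inj eq′
      ...   | fzero  | _  | ()
      ...   | fsuc _ | () | _
      step′ : ∀ j → Edge (α [ i ]≔ 0) (v (inject₁ j)) (v (fsuc j))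
      step′ j with via h h∈α joins ← Adj⇒Edge {α} (v (inject₁ j)) (v (fsuc j)) (step j) =
        via h (trans (Vecₚ.lookup∘update′ (λ { refl → not-closing j joins }) α 0) h∈α) joins
      walk : ∀ k (v : Fin (suc k) → V) → (∀ j → Edge (α [ i ]≔ 0) (v (inject₁ j)) (v (fsuc j))) →
        Conn (α [ i ]≔ 0) (v fzero) (v (fromℕ k))
      walk zero    v step = ε
      walk (suc k) v step = step fzero ◅ walk k (λ j → v (fsuc j)) (λ j → step (fsuc j))

    IsForest⇒Acyclic : ∀ {α} → IsForest α → Acyclic α
    IsForest⇒Acyclic {α} noCycle = acyclic λ i i∈α c → closeUp i i∈α (simplify i c)
      where
      module P i = SimplePaths _≟ᵛ_ (Edge (α [ i ]≔ 0))
      open P using (simplify)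
      closeUp : ∀ i → lookup α i ≡ 1 → ¬ ∃ (P.Path i (src i) (tgt i))
      -- Length one is excluded because the only edge with these ends is i, which was deleted. A
      -- path of length k + 2 has the k + 3 vertices that a cycle needs.
      closeUp i i∈α (suc zero , via j j∈ joins P.∷ (P.[] , _)) with refl ← Joins-unique joins (inj₁ (refl , refl)) =
        ℕₚ.0≢1+n (trans (sym (Vecₚ.lookup∘update j α 0)) j∈)
      closeUp i i∈α (suc (suc k) , p) = noCycle (k , P.at i p , P.at-injective i p ,
        (λ j → Edge⇒Adj {α} (weaken (P.at-step i p j))) ,
        subst (λ v → Adj α v (src i)) (sym (P.at-last i p)) (Edge⇒Adj {α} (via i i∈α (inj₂ (refl , refl)))))
        where
        weaken : ∀ {u v} → Edge (α [ i ]≔ 0) u v → Edge α u v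
        weaken (via j j∈ joins) = via j (≔0-⊑ α i j j∈) joins

    IsBasisMon⇒Forest : ∀ {r α} → IsBasisMon r α → Forest r α
    IsBasisMon⇒Forest (z , d , noCycle) = forest z d (IsForest⇒Acyclic noCycle)

    Forest⇒IsBasisMon : ∀ {r α} → Forest r α → IsBasisMon r α
    Forest⇒IsBasisMon (forest z d acyc) = z , d , λ cycle → HasCycle⇒¬Acyclic cycle acyc

    swapLeft : Fin m → Fin m → Involution
    swapLeft x y = record
      { τ    = λ i → combine (swap x y (left i)) (right i)
      ; ρ    = λ { (inj₁ a) → inj₁ (swap x y a) ; (inj₂ b) → inj₂ b }
      ; τ-τ  = λ i → trans (cong₂ combine (trans (cong (swap x y) (left-combine _ _)) (swap-involutive x y (left i)))
          (right-combine _ _)) (combine-left-right i)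
      ; ρ-ρ  = λ { (inj₁ a) → cong inj₁ (swap-involutive x y a) ; (inj₂ b) → refl }
      ; srcτ = λ i → cong inj₁ (left-combine _ _)
      ; tgtτ = λ i → cong inj₂ (right-combine _ _)
      }

    swapRight : Fin n → Fin n → Involution
    swapRight x y = record
      { τ    = λ i → combine (left i) (swap x y (right i))
      ; ρ    = λ { (inj₁ a) → inj₁ a ; (inj₂ b) → inj₂ (swap x y b) }
      ; τ-τ  = λ i → trans (cong₂ combine (left-combine _ _)
          (trans (cong (swap x y) (right-combine (left i) _)) (swap-involutive x y (right i)))) (combine-left-right i)
      ; ρ-ρ  = λ { (inj₁ a) → refl ; (inj₂ b) → cong inj₂ (swap-involutive x y b) }
      ; srcτ = λ i → cong inj₁ (left-combine _ _)
      ; tgtτ = λ i → cong inj₂ (right-combine (left i) _)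
      }

    -- The matrix entry at the edges ab and a′b′. The arguments are grouped by side, so that the two
    -- symmetric groups act on separate pairs.
    entry : ℕ → Fin m → Fin m → Fin n → Fin n → ℕ
    entry k a a′ b b′ = ♯ k (combine a b) (inj₁ a′) (inj₂ b′)

    entry-swapLeft : ∀ k x y a a′ b b′ → entry k a a′ b b′ ≡ entry k (swap x y a) (swap x y a′) b b′
    entry-swapLeft k x y a a′ b b′ = trans (Involution.♯-act (swapLeft x y) k (combine a b) (inj₁ a′) (inj₂ b′))
      (cong (λ i → ♯ k i (inj₁ (swap x y a′)) (inj₂ b′))
        (cong₂ combine (cong (swap x y) (left-combine a b)) (right-combine a b)))

    entry-swapRight : ∀ k x y a a′ b b′ → entry k a a′ b b′ ≡ entry k a a′ (swap x y b) (swap x y b′)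
    entry-swapRight k x y a a′ b b′ = trans (Involution.♯-act (swapRight x y) k (combine a b) (inj₁ a′) (inj₂ b′))
      (cong (λ i → ♯ k i (inj₁ a′) (inj₂ (swap x y b′)))
        (cong₂ combine (left-combine a b) (cong (swap x y) (right-combine a b))))

    entry-same : ∀ k a b → entry k a a b b ≡ 0
    entry-same k a b = subst₂ (λ u v → ♯ k (combine a b) u v ≡ 0)
      (cong inj₁ (left-combine a b)) (cong inj₂ (right-combine a b)) (♯-joined k (combine a b))

    entry-exchangeLeft : ∀ k {a a′} b b′ → a ≢ a′ → entry k a a b b′ ≤ entry k a a′ b b′
    entry-exchangeLeft k {a} {a′} b b′ a≢a′ = Exchange.♯-exchange (swapLeft a a′)
      (cong inj₁ (swap-right a a′)) fix loopless (λ ()) (Joins-combine a b) (λ { refl → a≢a′ refl }) k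
      where
      fix : ∀ {v} → v ≢ inj₁ a → v ≢ inj₁ a′ → Involution.ρ (swapLeft a a′) v ≡ v
      fix {inj₁ _} v≢a v≢a′ = cong inj₁ (swap-other a a′ (λ { refl → v≢a refl }) (λ { refl → v≢a′ refl }))
      fix {inj₂ _} _ _ = refl

    entry-exchangeRight : ∀ k a a′ {b b′} → b ≢ b′ → entry k a a′ b b ≤ entry k a a′ b b′
    entry-exchangeRight k a a′ {b} {b′} b≢b′ = ≤-trans (♯-sym k (combine a b) (inj₁ a′) (inj₂ b))
      (≤-trans (Exchange.♯-exchange (swapRight b b′) (cong inj₂ (swap-right b b′)) fix loopless (λ ())
        (Joins-sym (Joins-combine a b)) (λ { refl → b≢b′ refl }) k)
        (♯-sym k (combine a b) (inj₂ b′) (inj₁ a′)))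
      where
      fix : ∀ {v} → v ≢ inj₂ b → v ≢ inj₂ b′ → Involution.ρ (swapRight b b′) v ≡ v
      fix {inj₁ _} _ _ = refl
      fix {inj₂ _} v≢b v≢b′ = cong inj₂ (swap-other b b′ (λ { refl → v≢b refl }) (λ { refl → v≢b′ refl }))

    -- Stars as witnesses for positive and strict counts.

    Isolated : Mon (m * n) → V → Set
    Isolated α u = ∀ {v} → ¬ Edge α u v

    Isolated-¬Conn : ∀ {α u v} → Isolated α u → u ≢ v → ¬ Conn α u v
    Isolated-¬Conn iso u≢v ε       = u≢v refl
    Isolated-¬Conn iso u≢v (e ◅ _) = iso e

    -- The leaves are the right vertices numbered below k. Isolation of all remaining vertices is
    -- carried along because it permits the next edge to be added and supplies the separations
    -- wanted in the end.
    record StarForest (a : Fin m) (k : ℕ) : Set where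
      field
        edges         : Mon (m * n)
        isForest      : Forest k edges
        contains      : ∀ b → toℕ b < k → lookup edges (combine a b) ≡ 1
        isolatedLeft  : ∀ a′ → a′ ≢ a → Isolated edges (inj₁ a′)
        isolatedRight : ∀ b → k ≤ toℕ b → Isolated edges (inj₂ b)

    star : ∀ a k → k ≤ n → StarForest a k
    star a zero _ = record
      { edges = replicate _ 0
      ; isForest = forest (λ i → ≤-trans (≤-reflexive (Vecₚ.lookup-replicate i 0)) z≤n) (deg-replicate (m * n))
          (acyclic λ i i∈ _ → empty i i∈)
      ; contains = λ _ ()
      ; isolatedLeft = λ _ _ (via i i∈ _) → empty i i∈
      ; isolatedRight = λ _ _ (via i i∈ _) → empty i i∈
      }
      where
      empty : ∀ i → ¬ lookup (replicate (m * n) 0) i ≡ 1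
      empty i i∈ with () ← trans (sym (Vecₚ.lookup-replicate i 0)) i∈
    star a (suc k) k<n = record
      { edges = β
      ; isForest = forest (ZeroOne-≔ α i ≤-refl zeroOne) (trans (deg-≔1 α i i∉α) (cong suc degree))
          (Acyclic-add i∉α (Joins-combine a b) acycle 
            (λ c → Isolated-¬Conn (isolatedRight b (≤-reflexive (sym toℕ-b))) (λ ()) (Conn-sym c)))
      ; contains = contains′
      ; isolatedLeft = λ a′ a′≢a e → [ isolatedLeft a′ a′≢a , (λ j → a′≢a (leftEnd j)) ]′ (old e)
      ; isolatedRight = λ b′ k<b′ e →
          [ isolatedRight b′ (ℕₚ.<⇒≤ k<b′)
          , (λ j → ℕₚ.<⇒≢ k<b′ (trans (sym toℕ-b) (cong toℕ (rightEnd j))))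
          ]′ (old e)
      }
      where
      open StarForest (star a k (ℕₚ.<⇒≤ k<n)) renaming (edges to α)
      open Forest isForest
      b = Fin.fromℕ< k<n
      toℕ-b : toℕ b ≡ k
      toℕ-b = Finₚ.toℕ-fromℕ< k<n
      i = combine a b
      β = α [ i ]≔ 1
      i∉α : lookup α i ≡ 0
      i∉α = ≤1∧≢1⇒≡0 (zeroOne i) λ i∈α →
        isolatedRight b (≤-reflexive (sym toℕ-b)) (via i i∈α (Joins-sym (Joins-combine a b)))
      contains′ : ∀ b′ → toℕ b′ < suc k → lookup β (combine a b′) ≡ 1
      contains′ b′ b′<1+k with ℕₚ.m<1+n⇒m<n∨m≡n b′<1+k
      ... | inj₁ b′<k = ⊑-≔1 α i _ (contains b′ b′<k)
      ... | inj₂ b′≡k rewrite Finₚ.toℕ-injective (trans b′≡k (sym toℕ-b)) = Vecₚ.lookup∘update i α 1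
      old : ∀ {u v} → Edge β u v → Edge α u v ⊎ Joins i u v
      old (via j j∈ joins) with j Finₚ.≟ i
      ... | yes refl = inj₂ joins
      ... | no j≢i = inj₁ (via j (trans (sym (Vecₚ.lookup∘update′ j≢i α 1)) j∈) joins)
      leftEnd : ∀ {a′ v} → Joins i (inj₁ a′) v → a′ ≡ a
      leftEnd (inj₁ (eq , _)) = trans (sym (Sumₚ.inj₁-injective eq)) (left-combine a b)
      rightEnd : ∀ {b′ v} → Joins i (inj₂ b′) v → b ≡ b′
      rightEnd (inj₂ (_ , eq)) = trans (sym (right-combine a b)) (Sumₚ.inj₂-injective eq)

    module _ {a : Fin m} {k : ℕ} {b : Fin n} (S : StarForest a k) (b<k : toℕ b < k) where
      open StarForest S

      star-separates-right : ∀ {b′} → k ≤ toℕ b′ → ∀ a′ → Separating k (combine a b) (inj₁ a′) (inj₂ b′) edges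
      star-separates-right k≤b′ a′ = separating isForest (contains b b<k)
        λ c → Isolated-¬Conn (isolatedRight _ k≤b′) (λ ()) (Conn-sym c)

      star-separates-left : ∀ {a′} → a′ ≢ a → ∀ b′ → Separating k (combine a b) (inj₁ a′) (inj₂ b′) edges
      star-separates-left a′≢a b′ = separating isForest (contains b b<k)
        λ c → Isolated-¬Conn (isolatedLeft _ a′≢a) (λ ()) c

  -- The matrix as a combination of four commuting matrices.

  δ : ∀ {n} → Fin n → Fin n → ℕ
  δ i j = lookup (unit j) i

  -- For h with values 0, p, q, s this holds with v = s - p, w = s - q, u = p + q - s; as a matrix on
  -- K^m ⊗ K^n, h then has the eigenvalues t, - (n v + u), - (m w + u) and - u.
  record Spectrum {m n : ℕ} (h : Fin m → Fin m → Fin n → Fin n → ℕ) : Set where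
    field
      {s u v w t} : ℕ
      balance : ∀ a a′ b b′ → h a a′ b b′ + (w * δ b b′ + (v * δ a a′ + u * (δ a a′ * δ b b′))) ≡ s
      total   : t + (w * m + (v * n + u)) ≡ s * (m * n)
      0<u     : 0 < u
      0<t     : 0 < t

  module _ {m n : ℕ} (h : Fin (suc m) → Fin (suc m) → Fin (suc n) → Fin (suc n) → ℕ) where

    spectrum : ∀ {p q s} → p ≤ s → q ≤ s → s < p + q → 0 < n →
      (∀ a b → h a a b b ≡ 0) →
      (∀ a {b b′} → b ≢ b′ → h a a b b′ ≡ p) →
      (∀ {a a′} b → a ≢ a′ → h a a′ b b ≡ q) →
      (∀ {a a′ b b′} → a ≢ a′ → b ≢ b′ → h a a′ b b′ ≡ s) → Spectrum h
    spectrum {p} {q} {s} p≤s q≤s s<p+q 0<n is0 isP isQ isS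
      with v , refl ← ℕₚ.m≤n⇒∃[o]m+o≡n p≤s
      with w , q+w≡s ← ℕₚ.m≤n⇒∃[o]m+o≡n q≤s
      with u , s+u≡p+q ← ℕₚ.m≤n⇒∃[o]m+o≡n s<p+q = record
        -- The value t is a row sum of h: the sides have m + 1 and n + 1 vertices, so a given edge
        -- shares its left vertex with n others, its right vertex with m others, and is disjoint
        -- from m n.
        { s = p + v ; u = suc u ; v = v ; w = w ; t = p * n + (q * m + (p + v) * (m * n))
        ; balance = balance ; total = total ; 0<u = s≤s z≤n
        ; 0<t = ≤-trans (ℕₚ.*-mono-≤ 0<p 0<n) (ℕₚ.m≤m+n (p * n) _) }
      where
      0<p : 0 < p
      0<p = ℕₚ.+-cancelʳ-< q 0 p (ℕₚ.≤-<-trans q≤s s<p+q)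
      v+u≡q : v + suc u ≡ q
      v+u≡q = ℕₚ.+-cancelˡ-≡ p _ _ (trans (regroup p v u) s+u≡p+q)
        where
        regroup : ∀ p v u → p + (v + suc u) ≡ suc (p + v) + u
        regroup = solve-∀
      balance : ∀ a a′ b b′ → h a a′ b b′ + (w * δ b b′ + (v * δ a a′ + suc u * (δ a a′ * δ b b′))) ≡ p + v
      balance a a′ b b′ with a Finₚ.≟ a′ | b Finₚ.≟ b′
      ... | yes refl | yes refl rewrite is0 a b | lookup-unit a | lookup-unit b =
        trans (regroup w v u) (trans (cong (_+ w) v+u≡q) q+w≡s)
        where
        regroup : ∀ w v u → w * 1 + (v * 1 + suc u * 1) ≡ (v + suc u) + w
        regroup = solve-∀
      ... | yes refl | no b≢b′ rewrite isP a b≢b′ | lookup-unit a | lookup-unit-≢ b≢b′ = regroup p w v u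
        where
        regroup : ∀ p w v u → p + (w * 0 + (v * 1 + suc u * 0)) ≡ p + v
        regroup = solve-∀
      ... | no a≢a′ | yes refl rewrite isQ b a≢a′ | lookup-unit-≢ a≢a′ | lookup-unit b = trans (regroup q w v u) q+w≡s
        where
        regroup : ∀ q w v u → q + (w * 1 + (v * 0 + suc u * 0)) ≡ q + w
        regroup = solve-∀
      ... | no a≢a′ | no b≢b′ rewrite isS a≢a′ b≢b′ | lookup-unit-≢ a≢a′ | lookup-unit-≢ b≢b′ = regroup p w v u
        where
        regroup : ∀ p w v u → p + v + (w * 0 + (v * 0 + suc u * 0)) ≡ p + v
        regroup = solve-∀
      total : p * n + (q * m + (p + v) * (m * n)) + (w * suc m + (v * suc n + suc u)) ≡ (p + v) * (suc m * suc n)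
      total = begin
        p * n + (q * m + (p + v) * (m * n)) + (w * suc m + (v * suc n + suc u))
          ≡⟨ collect p q v w u m n ⟩
        (q + w) * m + (p + v) * n + (p + v) * (m * n) + ((v + suc u) + w)
          ≡⟨ cong (λ z → (q + w) * m + (p + v) * n + (p + v) * (m * n) + (z + w)) v+u≡q ⟩
        (q + w) * m + (p + v) * n + (p + v) * (m * n) + (q + w)
          ≡⟨ cong (λ z → z * m + (p + v) * n + (p + v) * (m * n) + z) q+w≡s ⟩
        (p + v) * m + (p + v) * n + (p + v) * (m * n) + (p + v)
          ≡⟨ factor (p + v) m n ⟩
        (p + v) * (suc m * suc n) ∎
        where
        open ≡-Reasoning
        collect : ∀ p q v w u m n → p * n + (q * m + (p + v) * (m * n)) + (w * suc m + (v * suc n + suc u)) ≡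
          (q + w) * m + (p + v) * n + (p + v) * (m * n) + ((v + suc u) + w)
        collect = solve-∀
        factor : ∀ s m n → s * m + s * n + s * (m * n) + s ≡ s * (suc m * suc n)
        factor = solve-∀

  Spectrum-exists : ∀ m n k → 1 ≤ m → 0 < k → suc k < n → Spectrum (CompleteBipartite.entry m n k)
  Spectrum-exists (suc m) (suc (suc n)) (suc k) _ _ (s≤s (s≤s k<n)) = cases m
    where
    k≤n : suc k ≤ suc (suc n)
    k≤n = ℕₚ.m≤n⇒m≤1+n (ℕₚ.m≤n⇒m≤1+n k<n)
    k≤l : suc k ≤ toℕ (fromℕ (suc n))
    k≤l = ≤-trans (ℕₚ.m≤n⇒m≤1+n k<n) (≤-reflexive (sym (Finₚ.toℕ-fromℕ (suc n))))
    cases : ∀ m → Spectrum (CompleteBipartite.entry (suc m) (suc (suc n)) (suc k))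
    -- With a single left vertex any two edges share it, so q and s are free; setting both to p
    -- gives v = w = 0 and u = p.
    cases zero = spectrum (entry (suc k)) {p = p} ≤-refl ≤-refl (ℕₚ.m<m+n p 0<p) (s≤s z≤n)
        (entry-same (suc k)) (λ { fzero b≢b′ → isP b≢b′ }) (λ { {fzero} {fzero} _ a≢a′ → ⊥-elim (a≢a′ refl) })
        (λ { {fzero} {fzero} a≢a′ _ → ⊥-elim (a≢a′ refl) })
      where
      open CompleteBipartite 1 (suc (suc n))
      l = fromℕ (suc n)
      p = entry (suc k) fzero fzero fzero l
      isP : ∀ {b b′} → b ≢ b′ → entry (suc k) fzero fzero b b′ ≡ p
      isP b≢b′ = SwapInvariant.off-diagonal (entry (suc k) fzero fzero)
        (λ x y → entry-swapRight (suc k) x y fzero fzero) b≢b′ (λ ())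
      0<p : 0 < p
      0<p = count-pos (separating? (suc k) _ _ _) (Forest-∈ (StarForest.isForest S)) (star-separates-right S (s≤s z≤n) k≤l fzero)
        where S = star fzero (suc k) k≤n
    -- The star at the first left vertex, with leaves 0 to k, misses both the last right vertex `l`
    -- and the second left vertex `a₁`; it is the forest counted twice.
    cases (suc m) = spectrum (entry (suc k))
        (entry-exchangeLeft (suc k) fzero l (λ ())) (entry-exchangeRight (suc k) fzero a₁ (λ ()))
        (♯-triangle (suc k) (Joins-combine fzero fzero)
          (star-separates-right S (s≤s z≤n) k≤l fzero) (star-separates-left S (s≤s z≤n) (λ ()) fzero))
        (s≤s z≤n) (entry-same (suc k))
        (λ a {b} {b′} b≢b′ → trans (Left.diagonal b b′ a fzero) (Right.off-diagonal fzero fzero b≢b′ o≢l))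
        (λ b a≢a′ → trans (Left.off-diagonal b b a≢a′ o≢a₁) (Right.diagonal fzero a₁ b fzero))
        (λ {_} {_} {b} {b′} a≢a′ b≢b′ →
          trans (Left.off-diagonal b b′ a≢a′ o≢a₁) (Right.off-diagonal fzero a₁ b≢b′ o≢l))
      where
      open CompleteBipartite (suc (suc m)) (suc (suc n))
      l = fromℕ (suc n)
      a₁ : Fin (suc (suc m))
      a₁ = fsuc fzero
      o≢a₁ : fzero ≢ a₁
      o≢a₁ ()
      o≢l : fzero ≢ l
      o≢l ()
      S = star fzero (suc k) k≤n
      module Left b b′ = SwapInvariant (λ a a′ → entry (suc k) a a′ b b′)
        (λ x y a a′ → entry-swapLeft (suc k) x y a a′ b b′)
      module Right a a′ = SwapInvariant (entry (suc k) a a′) (λ x y → entry-swapRight (suc k) x y a a′)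

open Combinatorics
open import Data.Nat as ℕ using (ℕ; zero; suc; _≤_; _<_; z≤n; s≤s; _∸_; _!)
open import Data.Nat.Properties as ℕₚ using (≤-trans)
open import Data.Empty using (⊥-elim)
open import Data.Fin as Fin using (Fin; combine) renaming (zero to fzero; suc to fsuc)
import Data.Fin.Properties as Finₚ
open import Data.Product using (∃; _×_; _,_; proj₁; proj₂)
open import Data.Sum using (inj₁; inj₂)
open import Data.List as List using (List; []; _∷_; _++_)
open import Data.List.Membership.Propositional using (_∈_)
open import Data.List.Relation.Unary.Any using (here; there)
open import Data.Vec using ([]; _∷_; lookup; _[_]≔_; zipWith; replicate)
import Data.Vec.Properties as Vecₚ
open import Relation.Unary using (Pred; Decidable)
open import Relation.Nullary using (¬_; Dec; yes; no)
import Relation.Binary.PropositionalEquality as ≡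
open ≡ using (_≡_; _≢_)
open import Level using (0ℓ)

-- Finite sums with values in the field.

module FieldSums {c ℓ} (K : Field c ℓ) where

  open Field K
  open import Algebra.Properties.Semiring.Sum semiring public using (sum; sum-cong-≋; *-distribˡ-sum; *-distribʳ-sum; ∑-distrib-+; ∑-comm)
  open import Algebra.Properties.CommutativeSemigroup +-commutativeSemigroup using (interchange)
  open import Relation.Binary.Reasoning.Setoid setoid

  -- The same fold as the sum in `Poly`, freed from the number of variables, so that results on it
  -- apply to `_⊗_` and `applyDiff` by definition.
  ΣL : {A : Set} → List A → (A → Carrier) → Carrier
  ΣL xs f = List.foldr (λ x acc → f x + acc) 0# xs

  fromℕ-+ : ∀ a b → fromℕ' (a ℕ.+ b) ≈ fromℕ' a + fromℕ' b
  fromℕ-+ zero    b = sym (+-identityˡ _)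
  fromℕ-+ (suc a) b = trans (+-congˡ (fromℕ-+ a b)) (sym (+-assoc _ _ _))

  fromℕ-* : ∀ a b → fromℕ' (a ℕ.* b) ≈ fromℕ' a * fromℕ' b
  fromℕ-* zero    b = sym (zeroˡ _)
  fromℕ-* (suc a) b = begin
    fromℕ' (b ℕ.+ a ℕ.* b)            ≈⟨ fromℕ-+ b (a ℕ.* b) ⟩
    fromℕ' b + fromℕ' (a ℕ.* b)       ≈⟨ +-cong (sym (*-identityˡ _)) (fromℕ-* a b) ⟩
    1# * fromℕ' b + fromℕ' a * fromℕ' b ≈⟨ distribʳ _ _ _ ⟨
    (1# + fromℕ' a) * fromℕ' b        ∎

  fromℕ-1 : fromℕ' 1 ≈ 1#
  fromℕ-1 = +-identityʳ 1#

  fromℕ-≡ : ∀ {a b} → a ≡ b → fromℕ' a ≈ fromℕ' b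
  fromℕ-≡ ≡.refl = refl

  fromℕ-inverse : CharZero → ∀ {a} → 0 < a → ∃ λ y → fromℕ' a * y ≈ 1#
  fromℕ-inverse char0 {suc a} _ = inverse (fromℕ' (suc a)) (char0 a)

  sum-const : ∀ n x → sum {n} (λ _ → x) ≈ fromℕ' n * x
  sum-const zero    x = sym (zeroˡ x)
  sum-const (suc n) x = trans (+-cong (sym (*-identityˡ x)) (sum-const n x)) (sym (distribʳ x _ _))

  sum-zero : ∀ {n} {f : Fin n → Carrier} → (∀ i → f i ≈ 0#) → sum f ≈ 0#
  sum-zero {n} eq = trans (sum-cong-≋ eq) (trans (sum-const n 0#) (zeroʳ _))

  module _ {A : Set} where

    ΣL-cong-∈ : ∀ xs {f g : A → Carrier} → (∀ {x} → x ∈ xs → f x ≈ g x) → ΣL xs f ≈ ΣL xs g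
    ΣL-cong-∈ []       eq = refl
    ΣL-cong-∈ (x ∷ xs) eq = +-cong (eq (here ≡.refl)) (ΣL-cong-∈ xs (λ x∈ → eq (there x∈)))

    ΣL-cong : ∀ xs {f g : A → Carrier} → (∀ x → f x ≈ g x) → ΣL xs f ≈ ΣL xs g
    ΣL-cong xs eq = ΣL-cong-∈ xs (λ {x} _ → eq x)

    ΣL-zero : ∀ (xs : List A) → ΣL xs (λ _ → 0#) ≈ 0#
    ΣL-zero []       = refl
    ΣL-zero (x ∷ xs) = trans (+-identityˡ _) (ΣL-zero xs)

    ΣL-++ : ∀ xs ys (f : A → Carrier) → ΣL (xs ++ ys) f ≈ ΣL xs f + ΣL ys f
    ΣL-++ []       ys f = sym (+-identityˡ _)
    ΣL-++ (x ∷ xs) ys f = trans (+-congˡ (ΣL-++ xs ys f)) (sym (+-assoc _ _ _))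

    ΣL-map : ∀ {B : Set} (h : B → A) xs (f : A → Carrier) → ΣL (List.map h xs) f ≈ ΣL xs (λ x → f (h x))
    ΣL-map h []       f = refl
    ΣL-map h (x ∷ xs) f = +-congˡ (ΣL-map h xs f)

    ΣL-+ : ∀ xs (f g : A → Carrier) → ΣL xs (λ x → f x + g x) ≈ ΣL xs f + ΣL xs g
    ΣL-+ []       f g = sym (+-identityˡ 0#)
    ΣL-+ (x ∷ xs) f g = trans (+-congˡ (ΣL-+ xs f g)) (interchange _ _ _ _)

    ΣL-* : ∀ xs y (f : A → Carrier) → ΣL xs (λ x → y * f x) ≈ y * ΣL xs f
    ΣL-* []       y f = sym (zeroʳ y)
    ΣL-* (x ∷ xs) y f = trans (+-congˡ (ΣL-* xs y f)) (sym (distribˡ _ _ _))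

    ΣL-sum : ∀ {n} xs (f : A → Fin n → Carrier) → ΣL xs (λ x → sum (f x)) ≈ sum (λ i → ΣL xs (λ x → f x i))
    ΣL-sum {n} []       f = sym (sum-zero {n} λ _ → refl)
    ΣL-sum     (x ∷ xs) f = trans (+-congˡ (ΣL-sum xs f)) (sym (∑-distrib-+ (f x) _))

    ΣL-indicator : ∀ {P : Pred A 0ℓ} (P? : Decidable P) xs →
      ΣL xs (λ x → fromℕ' (indicator (P? x))) ≈ fromℕ' (count P? xs)
    ΣL-indicator P? []       = refl
    ΣL-indicator P? (x ∷ xs) = trans (+-congˡ (ΣL-indicator P? xs))
      (trans (sym (fromℕ-+ (indicator (P? x)) _)) (fromℕ-≡ (≡.sym (count-∷ P? x xs))))

  sum-δ : ∀ {n} (f : Fin n → Carrier) j → sum (λ i → f i * fromℕ' (δ i j)) ≈ f j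
  sum-δ f fzero = trans (+-cong (trans (*-congˡ fromℕ-1) (*-identityʳ _))
      (sum-zero {f = λ i → f (fsuc i) * fromℕ' (δ (fsuc i) fzero)}
        λ i → trans (*-congˡ (fromℕ-≡ (Vecₚ.lookup-replicate i 0))) (zeroʳ _))) (+-identityʳ _)
  sum-δ f (fsuc j) = trans (+-cong (zeroʳ _) (sum-δ (λ i → f (fsuc i)) j)) (+-identityˡ _)

  sum-↑ : ∀ m {n} (f : Fin (m ℕ.+ n) → Carrier) → sum f ≈ sum (λ i → f (i Fin.↑ˡ n)) + sum (λ j → f (m Fin.↑ʳ j))
  sum-↑ zero    f = sym (+-identityˡ _)
  sum-↑ (suc m) f = trans (+-congˡ (sum-↑ m (λ i → f (fsuc i)))) (sym (+-assoc _ _ _))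

  sum-combine : ∀ m {n} (f : Fin (m ℕ.* n) → Carrier) → sum f ≈ sum (λ a → sum (λ b → f (combine {m} a b)))
  sum-combine zero        f = refl
  sum-combine (suc m) {n} f = trans (sum-↑ n f) (+-congˡ (sum-combine m (λ i → f (n Fin.↑ʳ i))))

  fromℕ-deg : ∀ {N} (α : Mon N) → sum (λ i → fromℕ' (lookup α i)) ≈ fromℕ' (deg α)
  fromℕ-deg []      = refl
  fromℕ-deg (a ∷ α) = trans (+-congˡ (fromℕ-deg α)) (sym (fromℕ-+ a (deg α)))

  -- With exponents at most 1 there are only two branches, and the second is switched on by the
  -- factor `fromℕ' a`.
  ΣL-below-∷ : ∀ {N} a (α : Mon N) → a ≤ 1 → (f : Mon (suc N) → Carrier) →
    ΣL (below (a ∷ α)) f ≈ ΣL (below α) (λ β → f (0 ∷ β)) + fromℕ' a * ΣL (below α) (λ β → f (1 ∷ β))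
  ΣL-below-∷ zero α _ f = begin
    ΣL (List.map (0 ∷_) (below α) ++ []) f ≈⟨ ΣL-++ (List.map (0 ∷_) (below α)) [] f ⟩
    ΣL (List.map (0 ∷_) (below α)) f + 0#  ≈⟨ +-cong (ΣL-map (0 ∷_) (below α) f) (sym (zeroˡ _)) ⟩
    ΣL (below α) (λ β → f (0 ∷ β)) + 0# * ΣL (below α) (λ β → f (1 ∷ β)) ∎
  ΣL-below-∷ (suc zero) α _ f = begin
    ΣL (List.map (0 ∷_) (below α) ++ List.map (1 ∷_) (below α) ++ []) f
      ≈⟨ ΣL-++ (List.map (0 ∷_) (below α)) _ f ⟩
    ΣL (List.map (0 ∷_) (below α)) f + ΣL (List.map (1 ∷_) (below α) ++ []) f
      ≈⟨ +-cong (ΣL-map (0 ∷_) (below α) f) (ΣL-++ (List.map (1 ∷_) (below α)) [] f) ⟩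
    ΣL (below α) (λ β → f (0 ∷ β)) + (ΣL (List.map (1 ∷_) (below α)) f + 0#)
      ≈⟨ +-congˡ (trans (+-identityʳ _) (ΣL-map (1 ∷_) (below α) f)) ⟩
    ΣL (below α) (λ β → f (0 ∷ β)) + ΣL (below α) (λ β → f (1 ∷ β))
      ≈⟨ +-congˡ (sym (trans (*-congʳ fromℕ-1) (*-identityˡ _))) ⟩
    ΣL (below α) (λ β → f (0 ∷ β)) + fromℕ' 1 * ΣL (below α) (λ β → f (1 ∷ β)) ∎
  ΣL-below-∷ (suc (suc _)) α (s≤s ()) f

  ΣL-below-deg0 : ∀ {N} (α : Mon N) → ZeroOne α → (f : Mon N → Carrier) →
    (∀ β → deg β ≢ 0 → f β ≈ 0#) → ΣL (below α) f ≈ f (replicate N 0)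
  ΣL-below-deg0 []      z f supp = +-identityʳ _
  ΣL-below-deg0 (a ∷ α) z f supp = begin
    ΣL (below (a ∷ α)) f ≈⟨ ΣL-below-∷ a α (z fzero) f ⟩
    ΣL (below α) (λ β → f (0 ∷ β)) + fromℕ' a * ΣL (below α) (λ β → f (1 ∷ β))
      ≈⟨ +-cong (ΣL-below-deg0 α (λ i → z (fsuc i)) (λ β → f (0 ∷ β)) (λ β → supp (0 ∷ β)))
           (trans (*-congˡ (trans (ΣL-cong (below α) (λ β → supp (1 ∷ β) (λ ()))) (ΣL-zero (below α)))) (zeroʳ _)) ⟩
    f (replicate _ 0) + 0# ≈⟨ +-identityʳ _ ⟩
    f (replicate _ 0) ∎

  -- This evaluates a product whose first factor is linear: only the variables dividing the
  -- squarefree monomial α contribute, and the exponent serves as the indicator of division.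
  ΣL-below-deg1 : ∀ {N} (α : Mon N) → ZeroOne α → (f : Mon N → Carrier) →
    (∀ β → deg β ≢ 1 → f β ≈ 0#) → ΣL (below α) f ≈ sum (λ i → fromℕ' (lookup α i) * f (unit i))
  ΣL-below-deg1 []      z f supp = trans (+-identityʳ _) (supp [] (λ ()))
  ΣL-below-deg1 (a ∷ α) z f supp = begin
    ΣL (below (a ∷ α)) f ≈⟨ ΣL-below-∷ a α (z fzero) f ⟩
    ΣL (below α) (λ β → f (0 ∷ β)) + fromℕ' a * ΣL (below α) (λ β → f (1 ∷ β))
      ≈⟨ +-cong (ΣL-below-deg1 α (λ i → z (fsuc i)) (λ β → f (0 ∷ β)) (λ β → supp (0 ∷ β)))
           (*-congˡ (ΣL-below-deg0 α (λ i → z (fsuc i)) (λ β → f (1 ∷ β))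
              (λ β d≢0 → supp (1 ∷ β) (λ d≡1 → d≢0 (ℕₚ.suc-injective d≡1))))) ⟩
    sum (λ i → fromℕ' (lookup α i) * f (0 ∷ unit i)) + fromℕ' a * f (1 ∷ replicate _ 0) ≈⟨ +-comm _ _ ⟩
    fromℕ' a * f (1 ∷ replicate _ 0) + sum (λ i → fromℕ' (lookup α i) * f (0 ∷ unit i)) ∎

-- Squarefree monomials and the coefficients of products with linear forms.

∸-unit : ∀ {N} (α : Mon N) i → lookup α i ≡ 1 → zipWith _∸_ α (unit i) ≡ α [ i ]≔ 0
∸-unit α i i∈α = Vec-ext λ j → ≡.trans (Vecₚ.lookup-zipWith _∸_ j α (unit i)) (at j)
  where
  at : ∀ j → lookup α j ∸ lookup (unit i) j ≡ lookup (α [ i ]≔ 0) j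
  at j with j Finₚ.≟ i
  ... | yes ≡.refl rewrite lookup-unit j | i∈α = ≡.sym (Vecₚ.lookup∘update j α 0)
  ... | no j≢i rewrite lookup-unit-≢ j≢i = ≡.sym (Vecₚ.lookup∘update′ j≢i α 0)

deg≡0⇒replicate : ∀ {N} (α : Mon N) → deg α ≡ 0 → α ≡ replicate N 0
deg≡0⇒replicate []         _ = ≡.refl
deg≡0⇒replicate (zero ∷ α) d = ≡.cong (0 ∷_) (deg≡0⇒replicate α d)

deg≡1⇒unit : ∀ {N} (α : Mon N) → deg α ≡ 1 → ∃ λ i → α ≡ unit i
deg≡1⇒unit (zero ∷ α)     d with i , ≡.refl ← deg≡1⇒unit α d = fsuc i , ≡.refl
deg≡1⇒unit (suc zero ∷ α) d = fzero , ≡.cong (1 ∷_) (deg≡0⇒replicate α (ℕₚ.suc-injective d))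

-- Differentiating a squarefree monomial produces only ratios of 0! and 1!.
fall-zeroOne : ∀ {N} (γ α : Mon N) → ZeroOne (zipWith ℕ._+_ γ α) → fall γ α ≡ 1
fall-zeroOne []      []      z = ≡.refl
fall-zeroOne (g ∷ γ) (a ∷ α) z = ≡.cong₂ ℕ._*_ (rise≡1 g a (z fzero)) (fall-zeroOne γ α (λ i → z (fsuc i)))
  where
  rise≡1 : ∀ g a → g ℕ.+ a ≤ 1 → rise g a ≡ 1
  rise≡1 g             zero       _        = ≡.refl
  rise≡1 zero          (suc zero) _        = ≡.refl
  rise≡1 zero          (suc (suc a)) (s≤s ())
  rise≡1 (suc zero)    (suc a)    (s≤s ())
  rise≡1 (suc (suc g)) (suc a)    (s≤s ())

module Powers {c ℓ} (K : Field c ℓ) (N : ℕ) where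
  open Field K
  open Poly K N
  open FieldSums K
  open import Relation.Binary.Reasoning.Setoid setoid

  one-deg0 : ∀ α → deg α ≡ 0 → one α ≈ 1#
  one-deg0 α d with deg α | d
  ... | zero | _ = refl

  Lsum-deg1 : ∀ α → deg α ≡ 1 → Lsum α ≈ 1#
  Lsum-deg1 α d with deg α | d
  ... | suc zero | _ = refl

  Lsum-homog : IsHomog 1 Lsum
  Lsum-homog α d with deg α
  ... | zero        = refl
  ... | suc zero    = ⊥-elim (d ≡.refl)
  ... | suc (suc _) = refl

  -- A squarefree monomial divided by one of its variables stays squarefree, so h enters only
  -- through its constant value y. Taking `Lsum` for f drives the induction for its powers; a
  -- general f then gives the multiples of such a power.
  linear-⊗ : ∀ f h y → IsHomog 1 f → ∀ k → (∀ β → ZeroOne β → deg β ≡ k → h β ≈ y) →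
    ∀ α → ZeroOne α → deg α ≡ suc k → (f ⊗ h) α ≈ y * sum (λ i → fromℕ' (lookup α i) * f (unit i))
  linear-⊗ f h y homog k h≈y α z d = begin
    (f ⊗ h) α
      ≈⟨ ΣL-below-deg1 α z (λ β → f β * h (zipWith _∸_ α β)) (λ β d≢1 → trans (*-congʳ (homog β d≢1)) (zeroˡ _)) ⟩
    sum (λ i → fromℕ' (lookup α i) * (f (unit i) * h (zipWith _∸_ α (unit i))))
      ≈⟨ sum-cong-≋ term ⟩
    sum (λ i → y * (fromℕ' (lookup α i) * f (unit i)))
      ≈⟨ *-distribˡ-sum y (λ i → fromℕ' (lookup α i) * f (unit i)) ⟨
    y * sum (λ i → fromℕ' (lookup α i) * f (unit i)) ∎
    where
    term : ∀ i → fromℕ' (lookup α i) * (f (unit i) * h (zipWith _∸_ α (unit i))) ≈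
      y * (fromℕ' (lookup α i) * f (unit i))
    term i with lookup α i ℕ.≟ 1
    ... | no i∉α rewrite ≤1∧≢1⇒≡0 (z i) i∉α = trans (zeroˡ _) (sym (trans (*-congˡ (zeroˡ _)) (zeroʳ _)))
    ... | yes i∈α = begin
      fromℕ' (lookup α i) * (f (unit i) * h (zipWith _∸_ α (unit i)))
        ≈⟨ *-congˡ (*-congˡ (trans (reflexive (≡.cong h (∸-unit α i i∈α)))
             (h≈y _ (ZeroOne-≔ α i z≤n z) (ℕₚ.suc-injective (≡.trans (deg-≔0 α i i∈α) d))))) ⟩
      fromℕ' (lookup α i) * (f (unit i) * y) ≈⟨ *-assoc _ _ _ ⟨
      fromℕ' (lookup α i) * f (unit i) * y   ≈⟨ *-comm _ _ ⟩
      y * (fromℕ' (lookup α i) * f (unit i)) ∎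

  Lsum-power : ∀ k α → ZeroOne α → deg α ≡ k → (Lsum ^^ k) α ≈ fromℕ' (k !)
  Lsum-power zero    α z d = trans (one-deg0 α d) (sym fromℕ-1)
  Lsum-power (suc k) α z d = begin
    (Lsum ⊗ (Lsum ^^ k)) α ≈⟨ linear-⊗ Lsum (Lsum ^^ k) (fromℕ' (k !)) Lsum-homog k (Lsum-power k) α z d ⟩
    fromℕ' (k !) * sum (λ i → fromℕ' (lookup α i) * Lsum (unit i))
      ≈⟨ *-congˡ (sum-cong-≋ λ i → trans (*-congˡ (Lsum-deg1 (unit i) (deg-unit i))) (*-identityʳ _)) ⟩
    fromℕ' (k !) * sum (λ i → fromℕ' (lookup α i)) ≈⟨ *-congˡ (trans (fromℕ-deg α) (fromℕ-≡ d)) ⟩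
    fromℕ' (k !) * fromℕ' (suc k) ≈⟨ *-comm _ _ ⟩
    fromℕ' (suc k) * fromℕ' (k !) ≈⟨ fromℕ-* (suc k) (k !) ⟨
    fromℕ' (suc k ℕ.* k !) ∎

  -- The sum is used in degree one only, since it need not vanish on monomials of higher degree.
  linearForm : (Fin N → Carrier) → Pol
  linearForm x α = restrict (deg α ℕ.≟ 1)
    where
    restrict : Dec (deg α ≡ 1) → Carrier
    restrict (yes _) = sum (λ i → x i * fromℕ' (lookup α i))
    restrict (no _)  = 0#

  linearForm-homog : ∀ x → IsHomog 1 (linearForm x)
  linearForm-homog x α d≢1 with deg α ℕ.≟ 1
  ... | yes d≡1 = ⊥-elim (d≢1 d≡1)
  ... | no _    = refl

  linearForm-unit : ∀ x j → linearForm x (unit j) ≈ x j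
  linearForm-unit x j with deg (unit j) ℕ.≟ 1
  ... | yes _   = sum-δ x j
  ... | no d≢1  = ⊥-elim (d≢1 (deg-unit j))

  applyDiff-difference : ∀ j P Q f γ → applyDiff j (P ⊕ (⊖ Q)) f γ ≈ applyDiff j P f γ + - applyDiff j Q f γ
  applyDiff-difference j P Q f γ = begin
    ΣL (monos N j) (λ α → (P α + - Q α) * D α)
      ≈⟨ ΣL-cong (monos N j) (λ α → trans (distribʳ _ _ _) (+-congˡ (trans (sym (-‿distribˡ-* (Q α) (D α))) (sym (-1*x≈-x _))))) ⟩
    ΣL (monos N j) (λ α → P α * D α + - 1# * (Q α * D α))
      ≈⟨ ΣL-+ (monos N j) (λ α → P α * D α) (λ α → - 1# * (Q α * D α)) ⟩
    ΣL (monos N j) (λ α → P α * D α) + ΣL (monos N j) (λ α → - 1# * (Q α * D α))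
      ≈⟨ +-congˡ (trans (ΣL-* (monos N j) (- 1#) (λ α → Q α * D α)) (-1*x≈-x _)) ⟩
    ΣL (monos N j) (λ α → P α * D α) + - ΣL (monos N j) (λ α → Q α * D α) ∎
    where
    open import Algebra.Properties.Ring ring using (-1*x≈-x; -‿distribˡ-*)
    D : Mon N → Carrier
    D α = fromℕ' (fall γ α) * f (zipWith ℕ._+_ γ α)

-- The action of multiples of a power of L on the basis generating polynomial.

module Hessian {c ℓ} (K : Field c ℓ) (m n : ℕ) where
  open Field K
  N = m ℕ.* n
  open Poly K N
  open FieldSums K
  open Powers K N
  open CompleteBipartite m n
  open import Relation.Binary.Reasoning.Setoid setoid

  module _ {r : ℕ} {Φ : Pol} (basis : Bip.IsBasisGenPoly m n K r Φ) where

    Φ-forest : ∀ {α} → Forest r α → Φ α ≈ 1#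
    Φ-forest {α} F = proj₁ (basis α) (Forest⇒IsBasisMon F)

    Φ-nonforest : ∀ {α} → ¬ Forest r α → Φ α ≈ 0#
    Φ-nonforest {α} ¬F = proj₂ (basis α) λ B → ¬F (IsBasisMon⇒Forest B)

    -- As Φ lives in degree r, an operator of order j leaves only monomials of degree r - j; for j =
    -- r - 1 these are the variables.
    applyDiff-degree : ∀ j P γ → deg γ ℕ.+ j ≢ r → applyDiff j P Φ γ ≈ 0#
    applyDiff-degree j P γ d = trans (ΣL-cong-∈ (monos N j) vanish) (ΣL-zero (monos N j))
      where
      vanish : ∀ {α} → α ∈ monos N j → P α * (fromℕ' (fall γ α) * Φ (zipWith ℕ._+_ γ α)) ≈ 0#
      vanish {α} α∈ = trans (*-congˡ (trans (*-congˡ (Φ-nonforest λ F →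
        d (≡.trans (≡.cong (deg γ ℕ.+_) (≡.sym (monos-deg α∈))) (≡.trans (≡.sym (deg-zipWith γ α)) (Forest.degree F))))) (zeroʳ _))) (zeroʳ _)

  module _ {k : ℕ} {Φ : Pol} (basis : Bip.IsBasisGenPoly m n K (suc (suc k)) Φ) where

    -- The formula is proved monomial by monomial in α, with the membership of i in α expressed by
    -- the indicator of `Separating`; only then are the sums over α and i interchanged, which turns
    -- indicators into counts.
    applyDiff-linear : ∀ f → IsHomog 1 f → ∀ e →
      applyDiff (suc k) (f ⊗ (Lsum ^^ k)) Φ (unit e) ≈
      fromℕ' (k !) * sum (λ i → f (unit i) * fromℕ' (♯ (suc k) i (src e) (tgt e)))
    applyDiff-linear f homog e = begin
      ΣL ms (λ α → (f ⊗ (Lsum ^^ k)) α * (fromℕ' (fall (unit e) α) * Φ (zipWith ℕ._+_ (unit e) α)))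
        ≈⟨ ΣL-cong ms term ⟩
      ΣL ms (λ α → fromℕ' (k !) * sum (λ i → f (unit i) * ind i α))
        ≈⟨ ΣL-* ms _ _ ⟩
      fromℕ' (k !) * ΣL ms (λ α → sum (λ i → f (unit i) * ind i α))
        ≈⟨ *-congˡ (ΣL-sum ms (λ α i → f (unit i) * ind i α)) ⟩
      fromℕ' (k !) * sum (λ i → ΣL ms (λ α → f (unit i) * ind i α))
        ≈⟨ *-congˡ (sum-cong-≋ λ i → trans (ΣL-* ms (f (unit i)) (ind i))
             (*-congˡ (ΣL-indicator (separating? (suc k) i (src e) (tgt e)) ms))) ⟩
      fromℕ' (k !) * sum (λ i → f (unit i) * fromℕ' (♯ (suc k) i (src e) (tgt e))) ∎
      where
      ms = monos N (suc k)
      ind : Fin N → Mon N → Carrier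
      ind i α = fromℕ' (indicator (separating? (suc k) i (src e) (tgt e) α))
      term : ∀ α → (f ⊗ (Lsum ^^ k)) α * (fromℕ' (fall (unit e) α) * Φ (zipWith ℕ._+_ (unit e) α)) ≈
        fromℕ' (k !) * sum (λ i → f (unit i) * ind i α)
      term α with forest? (suc (suc k)) (zipWith ℕ._+_ (unit e) α)
      -- If α with e added is no forest, then α separates the ends of e for no i, and both sides
      -- vanish.
      ... | no ¬F = trans (trans (*-congˡ (trans (*-congˡ (Φ-nonforest basis ¬F)) (zeroʳ _))) (zeroʳ _))
              (sym (trans (*-congˡ (sum-zero λ i → trans (*-congˡ (ind≈0 i)) (zeroʳ _))) (zeroʳ _)))
        where
        ind≈0 : ∀ i → ind i α ≈ 0#
        ind≈0 i with separating? (suc k) i (src e) (tgt e) α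
        ... | no _ = refl
        ... | yes (separating F _ s≁t) = ⊥-elim (¬F (Forest-unit-+⁺ F s≁t))
      ... | yes F⁺ with F , s≁t ← Forest-unit-+⁻ F⁺ = begin
        (f ⊗ (Lsum ^^ k)) α * (fromℕ' (fall (unit e) α) * Φ (zipWith ℕ._+_ (unit e) α))
          ≈⟨ *-congˡ (*-cong (trans (fromℕ-≡ (fall-zeroOne (unit e) α (Forest.zeroOne F⁺))) fromℕ-1) (Φ-forest basis F⁺)) ⟩
        (f ⊗ (Lsum ^^ k)) α * (1# * 1#)
          ≈⟨ trans (*-congˡ (*-identityˡ 1#)) (*-identityʳ _) ⟩
        (f ⊗ (Lsum ^^ k)) α
          ≈⟨ linear-⊗ f (Lsum ^^ k) (fromℕ' (k !)) homog k (Lsum-power k) α (Forest.zeroOne F) (Forest.degree F) ⟩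
        fromℕ' (k !) * sum (λ i → fromℕ' (lookup α i) * f (unit i))
          ≈⟨ *-congˡ (sum-cong-≋ λ i → trans (*-comm _ _) (*-congˡ (fromℕ-≡ (≡.sym (member i))))) ⟩
        fromℕ' (k !) * sum (λ i → f (unit i) * ind i α) ∎
        where
        -- Forest and separation being known for this α, membership of i is the only condition left,
        -- and the exponent itself records it.
        member : ∀ i → indicator (separating? (suc k) i (src e) (tgt e) α) ≡ lookup α i
        member i with separating? (suc k) i (src e) (tgt e) α
        ... | yes (separating _ i∈α _) = ≡.sym i∈α
        ... | no ¬sep = ≡.sym (≤1∧≢1⇒≡0 (Forest.zeroOne F i) λ i∈α → ¬sep (separating F i∈α s≁t))

-- Explicit inversion by row, column and total sums.

module LinearSystem {c ℓ} (K : Field c ℓ) (char0 : Field.CharZero K)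
  {m n : ℕ} {h : Fin m → Fin m → Fin n → Fin n → ℕ} (spec : Spectrum h) where

  open Field K
  open FieldSums K
  open Spectrum spec
  open import Algebra.Properties.Group +-group using (∙-cancelʳ; //-rightDividesˡ)
  open import Algebra.Solver.Ring.NaturalCoefficients.Default commutativeSemiring
  open import Relation.Binary.Reasoning.Setoid setoid

  private
    S = fromℕ' s
    U = fromℕ' u
    V = fromℕ' v
    W = fromℕ' w
    T₀ = fromℕ' t
    M = fromℕ' m
    N = fromℕ' n

  Matrix : Set c
  Matrix = Fin m → Fin n → Carrier

  rowSum : Matrix → Fin m → Carrier
  rowSum x a = sum (x a)

  colSum : Matrix → Fin n → Carrier
  colSum x b = sum (λ a → x a b)

  grandSum : Matrix → Carrier
  grandSum x = sum (rowSum x)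

  image : Matrix → Matrix
  image x a′ b′ = grandSum (λ a b → x a b * fromℕ' (h a a′ b b′))

  grandSum-cong : ∀ {x y : Matrix} → (∀ a b → x a b ≈ y a b) → grandSum x ≈ grandSum y
  grandSum-cong eq = sum-cong-≋ λ a → sum-cong-≋ (eq a)

  grandSum-+ : ∀ (x y : Matrix) → grandSum (λ a b → x a b + y a b) ≈ grandSum x + grandSum y
  grandSum-+ x y = trans (sum-cong-≋ λ a → ∑-distrib-+ (x a) (y a)) (∑-distrib-+ (rowSum x) (rowSum y))

  grandSum-* : ∀ z (x : Matrix) → grandSum (λ a b → z * x a b) ≈ z * grandSum x
  grandSum-* z x = trans (sum-cong-≋ λ a → sym (*-distribˡ-sum z (x a))) (sym (*-distribˡ-sum z (rowSum x)))

  balance′ : ∀ a a′ b b′ → fromℕ' (h a a′ b b′) + (W * fromℕ' (δ b b′) + (V * fromℕ' (δ a a′) +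
    U * (fromℕ' (δ a a′) * fromℕ' (δ b b′)))) ≈ S
  balance′ a a′ b b′ = begin
    fromℕ' (h a a′ b b′) + (W * B + (V * A + U * (A * B)))
      ≈⟨ +-congˡ (+-cong (fromℕ-* w _) (+-cong (fromℕ-* v _) (trans (fromℕ-* u _) (*-congˡ (fromℕ-* (δ a a′) (δ b b′)))))) ⟨
    fromℕ' (h a a′ b b′) + (fromℕ' (w ℕ.* δ b b′) + (fromℕ' (v ℕ.* δ a a′) + fromℕ' (u ℕ.* (δ a a′ ℕ.* δ b b′))))
      ≈⟨ +-congˡ (trans (fromℕ-+ (w ℕ.* δ b b′) _) (+-congˡ (fromℕ-+ (v ℕ.* δ a a′) _))) ⟨
    fromℕ' (h a a′ b b′) + fromℕ' (w ℕ.* δ b b′ ℕ.+ (v ℕ.* δ a a′ ℕ.+ u ℕ.* (δ a a′ ℕ.* δ b b′)))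
      ≈⟨ fromℕ-+ (h a a′ b b′) _ ⟨
    fromℕ' (h a a′ b b′ ℕ.+ (w ℕ.* δ b b′ ℕ.+ (v ℕ.* δ a a′ ℕ.+ u ℕ.* (δ a a′ ℕ.* δ b b′))))
      ≈⟨ fromℕ-≡ (balance a a′ b b′) ⟩
    S ∎
    where
    A = fromℕ' (δ a a′)
    B = fromℕ' (δ b b′)

  -- This is `balance` summed with weights x. From here on h enters only through this identity and
  -- `total′`, so the system involves just x and its row, column and total sums.
  image-balance : ∀ x a b → image x a b + (W * colSum x b + (V * rowSum x a + U * x a b)) ≈ S * grandSum x
  image-balance x a′ b′ = sym (begin
    S * grandSum x ≈⟨ grandSum-* S x ⟨
    grandSum (λ a b → S * x a b) ≈⟨ grandSum-cong expand ⟩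
    grandSum (λ a b → x a b * H a b + (W * (x a b * B b) + (V * (x a b * A a) + U * (x a b * B b * A a))))
      ≈⟨ trans (grandSum-+ (λ a b → x a b * H a b) _)
         (+-congˡ (trans (grandSum-+ (λ a b → W * (x a b * B b)) _) (+-congˡ (grandSum-+ (λ a b → V * (x a b * A a)) _)))) ⟩
    image x a′ b′ + (grandSum (λ a b → W * (x a b * B b)) + (grandSum (λ a b → V * (x a b * A a)) + grandSum (λ a b → U * (x a b * B b * A a))))
      ≈⟨ +-congˡ (+-cong (trans (grandSum-* W (λ a b → x a b * B b)) (*-congˡ column))
           (+-cong (trans (grandSum-* V (λ a b → x a b * A a)) (*-congˡ row))
             (trans (grandSum-* U (λ a b → x a b * B b * A a)) (*-congˡ point)))) ⟩
    image x a′ b′ + (W * colSum x b′ + (V * rowSum x a′ + U * x a′ b′)) ∎)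
    where
    H : Matrix
    H a b = fromℕ' (h a a′ b b′)
    A : Fin m → Carrier
    A a = fromℕ' (δ a a′)
    B : Fin n → Carrier
    B b = fromℕ' (δ b b′)
    expand : ∀ a b → S * x a b ≈ x a b * H a b + (W * (x a b * B b) + (V * (x a b * A a) + U * (x a b * B b * A a)))
    expand a b = trans (*-congʳ (sym (balance′ a a′ b b′)))
      (solve 7 (λ x H A B W V U → (H :+ (W :* B :+ (V :* A :+ U :* (A :* B)))) :* x :=
        x :* H :+ (W :* (x :* B) :+ (V :* (x :* A) :+ U :* (x :* B :* A)))) refl (x a b) (H a b) (A a) (B b) W V U)
    column : grandSum (λ a b → x a b * B b) ≈ colSum x b′
    column = sum-cong-≋ λ a → sum-δ (x a) b′
    row : grandSum (λ a b → x a b * A a) ≈ rowSum x a′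
    row = trans (sum-cong-≋ λ a → sym (*-distribʳ-sum (A a) (x a))) (sum-δ (rowSum x) a′)
    point : grandSum (λ a b → x a b * B b * A a) ≈ x a′ b′
    point = trans (sum-cong-≋ λ a → trans (sym (*-distribʳ-sum (A a) (λ b → x a b * B b))) (*-congʳ (sum-δ (x a) b′)))
      (sum-δ (λ a → x a b′) a′)

  total′ : T₀ + (W * M + (V * N + U)) ≈ S * (M * N)
  total′ = begin
    T₀ + (W * M + (V * N + U)) ≈⟨ +-congˡ (+-cong (fromℕ-* w m) (+-congʳ (fromℕ-* v n))) ⟨
    T₀ + (fromℕ' (w ℕ.* m) + (fromℕ' (v ℕ.* n) + U))
      ≈⟨ trans (fromℕ-+ t _) (+-congˡ (trans (fromℕ-+ (w ℕ.* m) _) (+-congˡ (fromℕ-+ (v ℕ.* n) u)))) ⟨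
    fromℕ' (t ℕ.+ (w ℕ.* m ℕ.+ (v ℕ.* n ℕ.+ u))) ≈⟨ fromℕ-≡ total ⟩
    fromℕ' (s ℕ.* (m ℕ.* n)) ≈⟨ trans (fromℕ-* s _) (*-congˡ (fromℕ-* m n)) ⟩
    S * (M * N) ∎

  Invertible : Carrier → Set _
  Invertible d = ∃ λ y → d * y ≈ 1#

  U-inv : Invertible U
  U-inv = fromℕ-inverse char0 0<u

  T₀-inv : Invertible T₀
  T₀-inv = fromℕ-inverse char0 0<t

  -- These are two of the eigenvalues up to sign. Although v or w may be zero, u keeps them positive
  -- as natural numbers.
  +U-inv : ∀ a b → Invertible (fromℕ' a * fromℕ' b + U)
  +U-inv a b with y , eq ← fromℕ-inverse char0 (≤-trans 0<u (ℕₚ.m≤n+m u (a ℕ.* b))) =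
    y , trans (*-congʳ (trans (+-congʳ (sym (fromℕ-* a b))) (sym (fromℕ-+ (a ℕ.* b) u)))) eq

  *-cancel : ∀ {d x y} → Invertible d → d * x ≈ d * y → x ≈ y
  *-cancel {d} {x} {y} (i , di≈1) eq = begin
    x           ≈⟨ step x ⟩
    i * (d * x) ≈⟨ *-congˡ eq ⟩
    i * (d * y) ≈⟨ step y ⟨
    y           ∎
    where
    step : ∀ x → x ≈ i * (d * x)
    step x = trans (sym (*-identityˡ x)) (trans (*-congʳ (trans (sym di≈1) (*-comm d i))) (*-assoc i d x))

  solveFor : ∀ {d} → Invertible d → ∀ e f → ∃ λ x → d * x + e ≈ f
  solveFor {d} (i , di≈1) e f = i * (f - e) , (begin
    d * (i * (f - e)) + e ≈⟨ +-congʳ (trans (sym (*-assoc d i _)) (trans (*-congʳ di≈1) (*-identityˡ _))) ⟩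
    (f - e) + e           ≈⟨ //-rightDividesˡ e f ⟩
    f                     ∎)

  sum-+-const : ∀ {k} (f : Fin k → Carrier) z → sum (λ i → f i + z) ≈ sum f + fromℕ' k * z
  sum-+-const {k} f z = trans (∑-distrib-+ f (λ _ → z)) (+-congˡ (sum-const k z))

  sum-affine : ∀ {k} d (x e : Fin k → Carrier) → sum (λ i → d * x i + e i) ≈ d * sum x + sum e
  sum-affine d x e = trans (∑-distrib-+ (λ i → d * x i) e) (+-congʳ (sym (*-distribˡ-sum d x)))

  -- A quantity fixed by linear equations has its sum fixed by the summed equation. This identifies
  -- numbers chosen in advance as the actual row, column and total sums.
  sum-solution : ∀ {k d} → Invertible d → (x e : Fin k → Carrier) → ∀ f y →
    (∀ i → d * x i + e i ≈ f) → d * y + sum e ≈ fromℕ' k * f → sum x ≈ y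
  sum-solution {k} {d} inv x e f y eqs eq = *-cancel inv (∙-cancelʳ (sum e) (d * sum x) (d * y) (begin
    d * sum x + sum e          ≈⟨ sum-affine d x e ⟨
    sum (λ i → d * x i + e i)  ≈⟨ sum-cong-≋ eqs ⟩
    sum {k} (λ _ → f)          ≈⟨ sum-const k f ⟩
    fromℕ' k * f               ≈⟨ eq ⟨
    d * y + sum e              ∎))

  colSum-total : ∀ x → sum (colSum x) ≈ grandSum x
  colSum-total x = ∑-comm (λ b a → x a b)

  -- The equations for T, R and C arise by summing `image-balance` for an unknown preimage of y over
  -- everything, over a row and over a column. They are solved independently; then x is read off
  -- pointwise, and it remains to check that T, R and C are its sums, where `total′` makes the
  -- choices consistent.
  module Solve (y : Matrix) where

    private
      Y = grandSum y

      T-eq : ∃ λ T → T₀ * T + 0# ≈ Y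
      T-eq = solveFor T₀-inv 0# Y

      T = proj₁ T-eq

      R-eq : ∀ a → ∃ λ R → (N * V + U) * R + (rowSum y a + W * T) ≈ S * (N * T)
      R-eq a = solveFor (+U-inv n v) _ _

      C-eq : ∀ b → ∃ λ C → (M * W + U) * C + (colSum y b + V * T) ≈ S * (M * T)
      C-eq b = solveFor (+U-inv m w) _ _

      R : Fin m → Carrier
      R a = proj₁ (R-eq a)

      C : Fin n → Carrier
      C b = proj₁ (C-eq b)

      x-eq : ∀ a b → ∃ λ x → U * x + (y a b + (W * C b + V * R a)) ≈ S * T
      x-eq a b = solveFor U-inv _ _

    solution : Matrix
    solution a b = proj₁ (x-eq a b)

    private
      T₀T≈Y : T₀ * T ≈ Y
      T₀T≈Y = trans (sym (+-identityʳ _)) (proj₂ T-eq)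

      R-total : sum R ≈ T
      R-total = sum-solution (+U-inv n v) R (λ a → rowSum y a + W * T) (S * (N * T)) T (λ a → proj₂ (R-eq a)) (begin
        (N * V + U) * T + sum (λ a → rowSum y a + W * T)
          ≈⟨ +-congˡ (trans (sum-+-const (rowSum y) (W * T)) (+-congʳ (sym T₀T≈Y))) ⟩
        (N * V + U) * T + (T₀ * T + M * (W * T))
          ≈⟨ solve 7 (λ N V U T T₀ M W → (N :* V :+ U) :* T :+ (T₀ :* T :+ M :* (W :* T)) :=
               (T₀ :+ (W :* M :+ (V :* N :+ U))) :* T) refl N V U T T₀ M W ⟩
        (T₀ + (W * M + (V * N + U))) * T ≈⟨ *-congʳ total′ ⟩
        S * (M * N) * T ≈⟨ solve 4 (λ S M N T → S :* (M :* N) :* T := M :* (S :* (N :* T))) refl S M N T ⟩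
        M * (S * (N * T)) ∎)

      C-total : sum C ≈ T
      C-total = sum-solution (+U-inv m w) C (λ b → colSum y b + V * T) (S * (M * T)) T (λ b → proj₂ (C-eq b)) (begin
        (M * W + U) * T + sum (λ b → colSum y b + V * T)
          ≈⟨ +-congˡ (trans (sum-+-const (colSum y) (V * T)) (+-congʳ (trans (colSum-total y) (sym T₀T≈Y)))) ⟩
        (M * W + U) * T + (T₀ * T + N * (V * T))
          ≈⟨ solve 7 (λ N V U T T₀ M W → (M :* W :+ U) :* T :+ (T₀ :* T :+ N :* (V :* T)) :=
               (T₀ :+ (W :* M :+ (V :* N :+ U))) :* T) refl N V U T T₀ M W ⟩
        (T₀ + (W * M + (V * N + U))) * T ≈⟨ *-congʳ total′ ⟩
        S * (M * N) * T ≈⟨ solve 4 (λ S M N T → S :* (M :* N) :* T := N :* (S :* (M :* T))) refl S M N T ⟩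
        N * (S * (M * T)) ∎)

      rows : ∀ a → rowSum solution a ≈ R a
      rows a = sum-solution U-inv (solution a) (λ b → y a b + (W * C b + V * R a)) (S * T) (R a) (λ b → proj₂ (x-eq a b)) (begin
        U * R a + sum (λ b → y a b + (W * C b + V * R a))
          ≈⟨ +-congˡ (trans (∑-distrib-+ (y a) _) (+-congˡ (trans (sum-affine W C (λ _ → V * R a))
               (+-cong (*-congˡ C-total) (sum-const n (V * R a)))))) ⟩
        U * R a + (rowSum y a + (W * T + N * (V * R a)))
          ≈⟨ solve 6 (λ U R y WT N V → U :* R :+ (y :+ (WT :+ N :* (V :* R))) := (N :* V :+ U) :* R :+ (y :+ WT))
               refl U (R a) (rowSum y a) (W * T) N V ⟩
        (N * V + U) * R a + (rowSum y a + W * T) ≈⟨ proj₂ (R-eq a) ⟩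
        S * (N * T) ≈⟨ solve 3 (λ S N T → S :* (N :* T) := N :* (S :* T)) refl S N T ⟩
        N * (S * T) ∎)

      cols : ∀ b → colSum solution b ≈ C b
      cols b = sum-solution U-inv (λ a → solution a b) (λ a → y a b + (W * C b + V * R a)) (S * T) (C b) (λ a → proj₂ (x-eq a b)) (begin
        U * C b + sum (λ a → y a b + (W * C b + V * R a))
          ≈⟨ +-congˡ (trans (∑-distrib-+ (λ a → y a b) _) (+-congˡ (trans (sum-cong-≋ λ a → +-comm (W * C b) (V * R a)) (trans (sum-affine V R (λ _ → W * C b))
               (+-cong (*-congˡ R-total) (sum-const m (W * C b))))))) ⟩
        U * C b + (colSum y b + (V * T + M * (W * C b)))
          ≈⟨ solve 6 (λ U C y VT M W → U :* C :+ (y :+ (VT :+ M :* (W :* C))) := (M :* W :+ U) :* C :+ (y :+ VT))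
               refl U (C b) (colSum y b) (V * T) M W ⟩
        (M * W + U) * C b + (colSum y b + V * T) ≈⟨ proj₂ (C-eq b) ⟩
        S * (M * T) ≈⟨ solve 3 (λ S M T → S :* (M :* T) := M :* (S :* T)) refl S M T ⟩
        M * (S * T) ∎)

    image-solution : ∀ a b → image solution a b ≈ y a b
    image-solution a b = ∙-cancelʳ (W * C b + (V * R a + U * solution a b)) _ _ (begin
      image solution a b + (W * C b + (V * R a + U * solution a b))
        ≈⟨ +-congˡ (+-cong (*-congˡ (cols b)) (+-congʳ (*-congˡ (rows a)))) ⟨
      image solution a b + (W * colSum solution b + (V * rowSum solution a + U * solution a b))
        ≈⟨ image-balance solution a b ⟩
      S * grandSum solution ≈⟨ *-congˡ (trans (sum-cong-≋ rows) R-total) ⟩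
      S * T ≈⟨ proj₂ (x-eq a b) ⟨
      U * solution a b + (y a b + (W * C b + V * R a))
        ≈⟨ solve 4 (λ Ux y WC VR → Ux :+ (y :+ (WC :+ VR)) := y :+ (WC :+ (VR :+ Ux)))
             refl (U * solution a b) (y a b) (W * C b) (V * R a) ⟩
      y a b + (W * C b + (V * R a + U * solution a b)) ∎)

  -- The summed equations with zero image make T, R, C and finally x vanish in this order, each
  -- being multiplied by an invertible number. No dimension count is involved.
  module Kernel (x : Matrix) (image≈0 : ∀ a b → image x a b ≈ 0#) where

    private
      T = grandSum x
      R = rowSum x
      C = colSum x

      *-cancel₀ : ∀ {d x} → Invertible d → d * x ≈ 0# → x ≈ 0#
      *-cancel₀ inv eq = *-cancel inv (trans eq (sym (zeroʳ _)))

      point : ∀ a b → W * C b + (V * R a + U * x a b) ≈ S * T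
      point a b = trans (sym (trans (+-congʳ (image≈0 a b)) (+-identityˡ _))) (image-balance x a b)

      row : ∀ a → W * T + (N * (V * R a) + U * R a) ≈ N * (S * T)
      row a = begin
        W * T + (N * (V * R a) + U * R a)
          ≈⟨ +-cong (*-congˡ (colSum-total x)) (+-cong (sum-const n (V * R a)) (sym (*-distribˡ-sum U (x a)))) ⟨
        W * sum C + (sum {n} (λ _ → V * R a) + sum (λ b → U * x a b))
          ≈⟨ trans (sum-affine W C _) (+-congˡ (∑-distrib-+ {n} (λ _ → V * R a) (λ b → U * x a b))) ⟨
        sum (λ b → W * C b + (V * R a + U * x a b)) ≈⟨ sum-cong-≋ (point a) ⟩
        sum {n} (λ _ → S * T) ≈⟨ sum-const n (S * T) ⟩
        N * (S * T) ∎

      col : ∀ b → M * (W * C b) + (V * T + U * C b) ≈ M * (S * T)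
      col b = begin
        M * (W * C b) + (V * T + U * C b)
          ≈⟨ +-cong (sum-const m (W * C b)) (trans (sum-affine V R _) (+-congˡ (sym (*-distribˡ-sum U (λ a → x a b))))) ⟨
        sum {m} (λ _ → W * C b) + sum (λ a → V * R a + U * x a b)
          ≈⟨ ∑-distrib-+ {m} (λ _ → W * C b) _ ⟨
        sum (λ a → W * C b + (V * R a + U * x a b)) ≈⟨ sum-cong-≋ (λ a → point a b) ⟩
        sum {m} (λ _ → S * T) ≈⟨ sum-const m (S * T) ⟩
        M * (S * T) ∎

      T≈0 : T ≈ 0#
      -- The total S M N T is computed twice, by `total′` and by summing `row`; the two results
      -- differ exactly by the multiple of T with coefficient `T₀`.
      T≈0 = *-cancel₀ T₀-inv (∙-cancelʳ ((W * M + (V * N + U)) * T) _ _ (begin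
        T₀ * T + (W * M + (V * N + U)) * T ≈⟨ distribʳ T T₀ _ ⟨
        (T₀ + (W * M + (V * N + U))) * T   ≈⟨ *-congʳ total′ ⟩
        S * (M * N) * T ≈⟨ solve 4 (λ S M N T → S :* (M :* N) :* T := M :* (N :* (S :* T))) refl S M N T ⟩
        M * (N * (S * T)) ≈⟨ sum-const m (N * (S * T)) ⟨
        sum {m} (λ _ → N * (S * T)) ≈⟨ sum-cong-≋ row ⟨
        sum (λ a → W * T + (N * (V * R a) + U * R a))
          ≈⟨ sum-cong-≋ (λ a → solve 5 (λ WT N V R U → WT :+ (N :* (V :* R) :+ U :* R) := (N :* V :+ U) :* R :+ WT) refl (W * T) N V (R a) U) ⟩
        sum (λ a → (N * V + U) * R a + W * T) ≈⟨ trans (sum-affine (N * V + U) R (λ _ → W * T)) (+-congˡ (sum-const m (W * T))) ⟩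
        (N * V + U) * T + M * (W * T)
          ≈⟨ solve 6 (λ N V U T M W → (N :* V :+ U) :* T :+ M :* (W :* T) := con 0 :+ (W :* M :+ (V :* N :+ U)) :* T) refl N V U T M W ⟩
        0# + (W * M + (V * N + U)) * T ∎))

      vanish : ∀ {z} y → z ≈ 0# → y * z ≈ 0#
      vanish y z≈0 = trans (*-congˡ z≈0) (zeroʳ y)

      R≈0 : ∀ a → R a ≈ 0#
      R≈0 a = *-cancel₀ (+U-inv n v) (begin
        (N * V + U) * R a ≈⟨ solve 4 (λ N V U R → (N :* V :+ U) :* R := con 0 :+ (N :* (V :* R) :+ U :* R)) refl N V U (R a) ⟩
        0# + (N * (V * R a) + U * R a) ≈⟨ +-congʳ (vanish W T≈0) ⟨
        W * T + (N * (V * R a) + U * R a) ≈⟨ row a ⟩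
        N * (S * T) ≈⟨ vanish N (vanish S T≈0) ⟩
        0# ∎)

      C≈0 : ∀ b → C b ≈ 0#
      C≈0 b = *-cancel₀ (+U-inv m w) (begin
        (M * W + U) * C b ≈⟨ solve 4 (λ M W U C → (M :* W :+ U) :* C := M :* (W :* C) :+ (con 0 :+ U :* C)) refl M W U (C b) ⟩
        M * (W * C b) + (0# + U * C b) ≈⟨ +-congˡ (+-congʳ (vanish V T≈0)) ⟨
        M * (W * C b) + (V * T + U * C b) ≈⟨ col b ⟩
        M * (S * T) ≈⟨ vanish M (vanish S T≈0) ⟩
        0# ∎)

    kernel≈0 : ∀ a b → x a b ≈ 0#
    kernel≈0 a b = *-cancel₀ U-inv (begin
      U * x a b ≈⟨ trans (+-identityˡ _) (+-identityˡ _) ⟨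
      0# + (0# + U * x a b) ≈⟨ +-cong (vanish W (C≈0 b)) (+-congʳ (vanish V (R≈0 a))) ⟨
      W * C b + (V * R a + U * x a b) ≈⟨ point a b ⟩
      S * T ≈⟨ vanish S T≈0 ⟩
      0# ∎)

-- Bijectivity of multiplication by the power of L.

open import Data.Nat using (_*_)

-- Here k stands for r - 2, so the target degree r - 1 is k + 1.
module Lefschetz {c ℓ} (K : Field c ℓ) (char0 : Field.CharZero K) (m n k : ℕ)
  (spec : Spectrum (CompleteBipartite.entry m n (suc k)))
  {Φ : Poly.Pol K (m * n)} (basis : Bip.IsBasisGenPoly m n K (suc (suc k)) Φ) where

  open Field K renaming (_*_ to _·_)
  open Poly K (m * n)
  open FieldSums K
  open Powers K (m * n)
  open CompleteBipartite m n
  open Hessian K m n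
  open LinearSystem K char0 spec
  open import Relation.Binary.Reasoning.Setoid setoid

  k! : Carrier
  k! = fromℕ' (k !)

  k!-inv : Invertible k!
  k!-inv = fromℕ-inverse char0 (ℕₚ.1≤n! k)

  applyDiff-image : ∀ f → IsHomog 1 f → ∀ a b →
    applyDiff (suc k) (f ⊗ (Lsum ^^ k)) Φ (unit (combine a b)) ≈ k! · image (λ a b → f (unit (combine a b))) a b
  applyDiff-image f homog a b = begin
    applyDiff (suc k) (f ⊗ (Lsum ^^ k)) Φ (unit (combine a b))
      ≈⟨ applyDiff-linear basis f homog (combine a b) ⟩
    k! · sum (λ i → f (unit i) · fromℕ' (♯ (suc k) i (src (combine a b)) (tgt (combine a b))))
      ≈⟨ *-congˡ (sum-cong-≋ λ i → *-congˡ (fromℕ-≡ (≡.cong₂ (♯ (suc k) i)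
           (≡.cong inj₁ (left-combine a b)) (≡.cong inj₂ (right-combine a b))))) ⟩
    k! · sum (λ i → f (unit i) · fromℕ' (♯ (suc k) i (inj₁ a) (inj₂ b)))
      ≈⟨ *-congˡ (sum-combine m (λ i → f (unit i) · fromℕ' (♯ (suc k) i (inj₁ a) (inj₂ b)))) ⟩
    k! · image (λ a b → f (unit (combine a b))) a b ∎

  -- Even f itself vanishes: its coefficients form a matrix with zero image, after cancelling k!.
  injective : ∀ f → IsHomog 1 f → InAnn Φ (suc k) (f ⊗ (Lsum ^^ k)) → InAnn Φ 1 f
  injective f homog ann γ =
    trans (ΣL-cong (monos (m * n) 1) λ α → trans (*-congʳ (f≈0 α)) (zeroˡ _)) (ΣL-zero (monos (m * n) 1))
    where
    x : Matrix
    x a b = f (unit (combine a b))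
    image≈0 : ∀ a b → image x a b ≈ 0#
    image≈0 a b = *-cancel k!-inv (trans (sym (applyDiff-image f homog a b)) (trans (ann (unit (combine a b))) (sym (zeroʳ _))))
    f≈0 : ∀ α → f α ≈ 0#
    f≈0 α with deg α ℕ.≟ 1
    ... | no d≢1 = homog α d≢1
    ... | yes d≡1 with i , ≡.refl ← deg≡1⇒unit α d≡1 =
      trans (reflexive (≡.cong (λ j → f (unit j)) (≡.sym (combine-left-right i)))) (Kernel.kernel≈0 x image≈0 (left i) (right i))

  -- Only the coefficients at single variables of the linear forms obtained from Φ have to be
  -- matched. Dividing the prescribed ones by k! beforehand compensates the factor in
  -- `applyDiff-image`.
  surjective : ∀ Q → ∃ λ f → IsHomog 1 f × InAnn Φ (suc k) (Q ⊕ (⊖ (f ⊗ (Lsum ^^ k))))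
  surjective Q = f , homog , ann
    where
    target : Fin (m * n) → Carrier
    target i = applyDiff (suc k) Q Φ (unit i)
    scaled : Matrix
    scaled a b = proj₁ k!-inv · target (combine a b)
    open Solve scaled
    x : Fin (m * n) → Carrier
    x i = solution (left i) (right i)
    f : Pol
    f = linearForm x
    homog : IsHomog 1 f
    homog = linearForm-homog x
    hit : ∀ a b → applyDiff (suc k) (f ⊗ (Lsum ^^ k)) Φ (unit (combine a b)) ≈ target (combine a b)
    hit a b = begin
      applyDiff (suc k) (f ⊗ (Lsum ^^ k)) Φ (unit (combine a b)) ≈⟨ applyDiff-image f homog a b ⟩
      k! · image (λ a b → f (unit (combine a b))) a b
        ≈⟨ *-congˡ (grandSum-cong λ a b → *-congʳ (trans (linearForm-unit x (combine a b))
             (reflexive (≡.cong₂ solution (left-combine a b) (right-combine a b))))) ⟩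
      k! · image solution a b ≈⟨ *-congˡ (image-solution a b) ⟩
      k! · (proj₁ k!-inv · target (combine a b)) ≈⟨ *-assoc _ _ _ ⟨
      k! · proj₁ k!-inv · target (combine a b)   ≈⟨ trans (*-congʳ (proj₂ k!-inv)) (*-identityˡ _) ⟩
      target (combine a b) ∎
    ann : InAnn Φ (suc k) (Q ⊕ (⊖ (f ⊗ (Lsum ^^ k))))
    ann γ with deg γ ℕ.≟ 1
    ... | no d≢1 = applyDiff-degree basis (suc k) _ γ
            (λ d → d≢1 (ℕₚ.+-cancelʳ-≡ (suc k) (deg γ) 1 d))
    ... | yes d≡1 with i , ≡.refl ← deg≡1⇒unit γ d≡1 = begin
      applyDiff (suc k) (Q ⊕ (⊖ (f ⊗ (Lsum ^^ k)))) Φ (unit i)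
        ≈⟨ applyDiff-difference (suc k) Q (f ⊗ (Lsum ^^ k)) Φ (unit i) ⟩
      target i + - applyDiff (suc k) (f ⊗ (Lsum ^^ k)) Φ (unit i)
        ≈⟨ +-congˡ (-‿cong (≡.subst (λ j → applyDiff (suc k) (f ⊗ (Lsum ^^ k)) Φ (unit j) ≈ target j)
             (combine-left-right i) (hit (left i) (right i)))) ⟩
      target i + - target i ≈⟨ -‿inverseʳ _ ⟩
      0# ∎

theorem3p9 : ∀ {c l} (K : Field c l) → Field.CharZero K →
    (m n r : ℕ) → 1 ≤ m → 1 ≤ n → 2 < r → r < n →
    (Φ : Poly.Pol K (m * n)) → Bip.IsBasisGenPoly m n K r Φ →
    let open Poly K (m * n) in
    (∀ ℓ → IsHomog 1 ℓ → InAnn Φ (r ∸ 1) (ℓ ⊗ (Lsum ^^ (r ∸ 2))) → InAnn Φ 1 ℓ)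
    × (∀ Q → IsHomog (r ∸ 1) Q →
    ∃ λ ℓ → IsHomog 1 ℓ × InAnn Φ (r ∸ 1) (Q ⊕ (⊖ (ℓ ⊗ (Lsum ^^ (r ∸ 2))))))
theorem3p9 K char0 m n (suc (suc k)) 1≤m _ _ r<n Φ basis = injective , λ Q _ → surjective Q
  where open Lefschetz K char0 m n k (Spectrum-exists m n (suc k) 1≤m (s≤s z≤n) r<n) basis
theorem3p9 K char0 m n (suc zero) _ _ (s≤s ())
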